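{- Let $m\ge 3$ be an integer and set $c_m:=3m^2/4$. Then for every integer $n\ge 1$, $$V_n(m)=\left(\tfrac{3m^2}{4}\right)^n\zeta_{\Delta_m}(n).$$ Moreover, let $H(w)=\prod_{j\in G_m\setminus Z}(\lambda_m(j)-w)$ be the reduced spectral polynomial of $\Delta_m$ and let $F$ be the rational function $$F(w)=-\frac{1}{m^2}\frac{H'(w)}{H(w)}.$$ Then for every integer $n\ge 1$, $$V_n(m)=3^n\left(\frac m2\right)^{2n}\cdot\frac{m^2}{(n-1)!}\,\partial_w^{\,n-1}F(w)\Big|_{w=0},$$ and $$\sum_{n\ge 1}V_n(m)\,\tau^n=c_m\tau\cdot m^2F(c_m\tau)$$ as an identity of formal power series in $\tau$ near $\tau=0$. The series on the left converges absolutely and uniformly on every closed disc $|\tau|\le R$ with $R<\frac1{c_m}\min_{j\in G_m\setminus Z}\lambda_m(j)$.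
   Context: For integers $n\ge1$, $m\ge3$, the $\mathrm{SU}(3)$ Verlinde sum is $$V_n(m)=3^nm^{2n}\sum_{\substack{(j,\ell,k)\in(\mathbb Z/m\mathbb Z\setminus\{0\})^3\\ j+\ell+k\equiv 0 \bmod m}}\Big(8\sin\frac{\pi j}{m}\sin\frac{\pi\ell}{m}\sin\frac{\pi k}{m}\Big)^{ -2n}.$$ $G_m=(\mathbb Z/m\mathbb Z)^2$ is the triangular discrete torus on $m^2$ vertices: the six neighbors of $x$ are $x\pm e_1$, $x\pm e_2$, $x\pm(e_1+e_2)$, where $e_1=(1,0)$, $e_2=(0,1)$. For $d\in G_m$, $T_d$ acts on functions $f:G_m\to\mathbb C$ (the space $\ell^2(G_m)$) by $(T_df)(x)=f(x+d)$, and $\Delta_d=(T_d-I)^*(T_d-I)=2I-T_d-T_{ -d}$. The higher-order Laplace operator is $\Delta_m=\frac14\Delta_{e_1}\Delta_{e_2}\Delta_{e_1+e_2}$. Its eigenvalues, counted with multiplicity, are indexed by $j=(a,b)\in G_m$ (eigenfunction $\frac1m e^{2\pi i(ax_1+bx_2)/m}$) and are $$\lambda_m(j)=16\sin^2(\pi a/m)\sin^2(\pi b/m)\sin^2(\pi(a+b)/m).$$ Let $Z=\{(a,b)\in G_m: a=0,\ b=0,\text{ or } a+b\equiv0 \bmod m\}$. The spectral zeta function (a sum over the nonzero eigenvalues) is $\zeta_{\Delta_m}(s)=\sum_{j\in G_m\setminus Z}\lambda_m(j)^{ -s}$. -}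

module Defs where

open import Algebra.Apartness.Bundles using (HeytingField; HeytingCommutativeRing)
import Algebra.Apartness.Properties.HeytingCommutativeRing as HeytingProperties
open import Algebra.Bundles using (CommutativeRing; Semiring)
import Algebra.Definitions.RawSemiring as RawSemiringDefs
import Algebra.Properties.Ring as RingProperties
open import Data.Fin.Base using (Fin; toℕ; fromℕ<)
open import Data.Fin.Properties using (toℕ<n; toℕ-fromℕ<)
open import Data.List.Base using (List; []; _∷_; foldr; map; allFin; cartesianProduct)
open import Data.Nat.Base as ℕ using (ℕ; zero; suc; NonZero; z≤n; s≤s; _!)
open import Data.Nat.DivMod using (_mod_; m<n⇒m%n≡m; m%n<n)
import Data.Nat.Properties as ℕₚ
open import Data.Product.Base using (Σ; ∃-syntax; _×_; _,_; proj₁; proj₂)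
open import Data.Sum.Base using (_⊎_; inj₁; inj₂)
open import Level using () renaming (_⊔_ to _⊔ˡ_; suc to lsuc)
open import Relation.Binary.Core using (Rel)
open import Relation.Binary.Lattice.Definitions using (Infimum; Supremum)
import Relation.Binary.PropositionalEquality as ≡
open ≡ using (_≡_)
import Relation.Binary.Reasoning.Setoid as SetoidReasoning
open import Relation.Binary.Structures using (IsStrictPartialOrder)
open import Relation.Nullary using (¬_; yes; no; contradiction)
open import Relation.Nullary.Decidable using (¬?; _×-dec_; _⊎-dec_)
open import Relation.Unary using (Pred; Decidable)

-- The real numbers, as an Archimedean, Cauchy complete ordered field; these
-- properties determine ℝ up to isomorphism.  The axioms are phrased with
-- apartness, so that both the classical reals and the Cauchy reals of
-- constructive analysis satisfy them; classically x # y is ¬ (x ≈ y).  The lattice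
-- operations and the square root are determined by the ordered field.
record RealField c ℓ₁ ℓ₂ : Set (lsuc (c ⊔ˡ ℓ₁ ⊔ˡ ℓ₂)) where
  infix  4 _<_ _≤_
  infixl 6 _⊓_ _⊔_
  field
    heytingField : HeytingField c ℓ₁ ℓ₂

  open HeytingField heytingField public

  commutativeRing : CommutativeRing c ℓ₁
  commutativeRing = HeytingCommutativeRing.commutativeRing heytingCommutativeRing

  open RawSemiringDefs (Semiring.rawSemiring (CommutativeRing.semiring commutativeRing)) public
    using (_^_) renaming (_×_ to _·_)

  fromℕ : ℕ → Carrier
  fromℕ n = n · 1#

  field
    _<_                  : Rel Carrier ℓ₂
    isStrictPartialOrder : IsStrictPartialOrder _≈_ _<_
    <⇒#                  : ∀ {x y} → x < y → x # y
    #⇒<⊎>                : ∀ {x y} → x # y → x < y ⊎ y < x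
    +-monoʳ-<            : ∀ z {x y} → x < y → z + x < z + y
    *-pos                : ∀ {x y} → 0# < x → 0# < y → 0# < x * y

  _≤_ : Rel Carrier ℓ₂
  x ≤ y = ¬ (y < x)

  field
    _⊓_         : Carrier → Carrier → Carrier
    _⊔_         : Carrier → Carrier → Carrier
    ⊓-infimum   : Infimum _≤_ _⊓_
    ⊔-supremum  : Supremum _≤_ _⊔_
    √_          : Carrier → Carrier
    √-nonneg    : ∀ {x} → 0# ≤ x → 0# ≤ √ x
    √-square    : ∀ {x} → 0# ≤ x → √ x * √ x ≈ x
    archimedean : ∀ x → ∃[ n ] x < fromℕ n

  ∣_∣ : Carrier → Carrier
  ∣ x ∣ = x ⊔ (- x)

  ConvergesTo : (ℕ → Carrier) → Carrier → Set (c ⊔ˡ ℓ₂)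
  ConvergesTo a L =
    ∀ ε → 0# < ε → ∃[ N ] (∀ n → N ℕ.≤ n → ∣ a n - L ∣ < ε)

  Cauchy : (ℕ → Carrier) → Set (c ⊔ˡ ℓ₂)
  Cauchy a =
    ∀ ε → 0# < ε → ∃[ N ] (∀ i j → N ℕ.≤ i → N ℕ.≤ j → ∣ a i - a j ∣ < ε)

  field
    complete : ∀ a → Cauchy a → ∃[ L ] ConvergesTo a L


module RealFieldProperties {c ℓ₁ ℓ₂} (ℝ : RealField c ℓ₁ ℓ₂) where
  open RealField ℝ
  open RingProperties (CommutativeRing.ring commutativeRing)
    using (-‿distribʳ-*; -‿distribˡ-*; -‿involutive)
  open HeytingProperties heytingCommutativeRing public
    using (x#0y#0→xy#0; #-congʳ; #-congˡ; 1#0; x-0≈x)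
  private module < = IsStrictPartialOrder isStrictPartialOrder
  open SetoidReasoning setoid

  inv : ∀ x → x # 0# → Carrier
  inv x x#0 = proj₁ (#⇒invertible x#0)

  inv-inverseʳ : ∀ x (x#0 : x # 0#) → x * inv x x#0 ≈ 1#
  inv-inverseʳ x x#0 =
    trans (*-congʳ (sym (x-0≈x x))) (proj₂ (proj₂ (#⇒invertible x#0)))

  neg⇒pos : ∀ {x} → x < 0# → 0# < - x
  neg⇒pos {x} x<0 =
    <.<-respʳ-≈ (+-identityʳ (- x)) (<.<-respˡ-≈ (-‿inverseˡ x) (+-monoʳ-< (- x) x<0))

  0<1 : 0# < 1#
  0<1 with #⇒<⊎> 1#0
  ... | inj₂ 0<1 = 0<1
  ... | inj₁ 1<0 = <.<-respʳ-≈ -1*-1≈1 (*-pos (neg⇒pos 1<0) (neg⇒pos 1<0))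
    where
    -1*-1≈1 : - 1# * - 1# ≈ 1#
    -1*-1≈1 = begin
      - 1# * - 1#     ≈⟨ -‿distribˡ-* 1# (- 1#) ⟨
      - (1# * - 1#)   ≈⟨ -‿cong (*-identityˡ (- 1#)) ⟩
      - (- 1#)        ≈⟨ -‿involutive 1# ⟩
      1#              ∎

  fromℕ-suc-pos : ∀ n → 0# < 1# + fromℕ n
  fromℕ-suc-pos zero    = <.<-respʳ-≈ (sym (+-identityʳ 1#)) 0<1
  fromℕ-suc-pos (suc n) =
    <.trans 0<1 (<.<-respˡ-≈ (+-identityʳ 1#) (+-monoʳ-< 1# (fromℕ-suc-pos n)))

  fromℕ-pos : ∀ n .{{_ : NonZero n}} → 0# < fromℕ n
  fromℕ-pos (suc n) = fromℕ-suc-pos n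

  pos⇒#0 : ∀ {x} → 0# < x → x # 0#
  pos⇒#0 0<x = #-sym (<⇒# 0<x)

  fromℕ#0 : ∀ n .{{_ : NonZero n}} → fromℕ n # 0#
  fromℕ#0 n = pos⇒#0 (fromℕ-pos n)

  inv#0 : ∀ x (x#0 : x # 0#) → inv x x#0 # 0#
  inv#0 x x#0 = invertible⇒# (x ,
    trans (*-congˡ (x-0≈x _)) (inv-inverseʳ x x#0) ,
    trans (*-congʳ (x-0≈x _)) (trans (*-comm _ _) (inv-inverseʳ x x#0)))

  inv-pos : ∀ x (x#0 : x # 0#) → 0# < x → 0# < inv x x#0
  inv-pos x x#0 0<x with #⇒<⊎> (inv#0 x x#0)
  ... | inj₂ 0<y = 0<y
  ... | inj₁ y<0 = contradiction (<.trans 0<1 1<0) (<.irrefl refl)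
    where
    0<-1 : 0# < - 1#
    0<-1 = <.<-respʳ-≈
      (trans (sym (-‿distribʳ-* x _)) (-‿cong (inv-inverseʳ x x#0)))
      (*-pos 0<x (neg⇒pos y<0))

    1<0 : 1# < 0#
    1<0 = <.<-respˡ-≈ (+-identityʳ 1#) (<.<-respʳ-≈ (-‿inverseʳ 1#) (+-monoʳ-< 1# 0<-1))

  infixl 7 _/ℕ_
  _/ℕ_ : Carrier → (n : ℕ) .{{_ : NonZero n}} → Carrier
  x /ℕ n = x * inv (fromℕ n) (fromℕ#0 n)

  ^#0 : ∀ {x} n → x # 0# → x ^ n # 0#
  ^#0 zero    x#0 = 1#0
  ^#0 (suc n) x#0 = x#0y#0→xy#0 x#0 (^#0 n x#0)

  fromℕ-+ : ∀ i j → fromℕ (i ℕ.+ j) ≈ fromℕ i + fromℕ j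
  fromℕ-+ zero    j = sym (+-identityˡ _)
  fromℕ-+ (suc i) j = trans (+-congˡ (fromℕ-+ i j)) (sym (+-assoc _ _ _))

  -- For 0 < x and 0 < i < n, the point x i / n lies strictly between 0 and x.
  module _ {x} (0<x : 0# < x) (n : ℕ) .{{_ : NonZero n}} where
    /ℕ-pos : ∀ i → 0 ℕ.< i → 0# < x * fromℕ i /ℕ n
    /ℕ-pos (suc i) _ =
      *-pos (*-pos 0<x (fromℕ-pos (suc i))) (inv-pos _ (fromℕ#0 n) (fromℕ-pos n))

    /ℕ-sum : ∀ i j → i ℕ.+ j ≡ n → x * fromℕ i /ℕ n + x * fromℕ j /ℕ n ≈ x
    /ℕ-sum i j ≡.refl = begin
      x * fromℕ i * d + x * fromℕ j * d ≈⟨ distribʳ d _ _ ⟨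
      (x * fromℕ i + x * fromℕ j) * d   ≈⟨ *-congʳ (distribˡ x _ _) ⟨
      x * (fromℕ i + fromℕ j) * d       ≈⟨ *-congʳ (*-congˡ (fromℕ-+ i j)) ⟨
      x * fromℕ n * d                   ≈⟨ *-assoc _ _ _ ⟩
      x * (fromℕ n * d)                 ≈⟨ *-congˡ (inv-inverseʳ _ (fromℕ#0 n)) ⟩
      x * 1#                            ≈⟨ *-identityʳ x ⟩
      x                                 ∎
      where d = inv (fromℕ n) (fromℕ#0 n)

    /ℕ-below : ∀ i → i ℕ.< n → x * fromℕ i /ℕ n < x
    /ℕ-below i i<n = <.<-respˡ-≈ (+-identityʳ _)
      (<.<-respʳ-≈ (/ℕ-sum i (n ℕ.∸ i) (ℕₚ.m+[n∸m]≡n (ℕₚ.<⇒≤ i<n)))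
        (+-monoʳ-< _ (/ℕ-pos (n ℕ.∸ i) (ℕₚ.m<n⇒0<n∸m i<n))))

  sumOver : ∀ {a} {A : Set a} → List A → (A → Carrier) → Carrier
  sumOver xs f = foldr (λ x s → f x + s) 0# xs

  -- partialSum a n = a 0 + … + a (n - 1)
  partialSum : (ℕ → Carrier) → ℕ → Carrier
  partialSum a zero    = 0#
  partialSum a (suc n) = partialSum a n + a n

  sinTerm : Carrier → ℕ → Carrier
  sinTerm x k = (- 1#) ^ k * ((x ^ (2 ℕ.* k ℕ.+ 1)) /ℕ ((2 ℕ.* k ℕ.+ 1) !))
    where instance _ = (2 ℕ.* k ℕ.+ 1) ℕₚ.!≢0


-- The sine function is the sum of its Taylor series, and π is its first
-- positive zero; both are thereby uniquely determined.
record Trigonometry {c ℓ₁ ℓ₂} (ℝ : RealField c ℓ₁ ℓ₂) : Set (c ⊔ˡ ℓ₁ ⊔ˡ ℓ₂) where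
  open RealField ℝ
  open RealFieldProperties ℝ
  field
    sin        : Carrier → Carrier
    sin-series : ∀ x → ConvergesTo (partialSum (sinTerm x)) (sin x)
    π          : Carrier
    π-pos      : 0# < π
    sin-π      : sin π ≈ 0#
    π-first    : ∀ x → 0# < x → x < π → sin x # 0#


module Complex {c ℓ₁ ℓ₂} (ℝ : RealField c ℓ₁ ℓ₂) where
  open RealField ℝ
  open RealFieldProperties ℝ

  record ℂ : Set c where
    constructor _+i_
    field
      re : Carrier
      im : Carrier
  open ℂ public

  0ℂ 1ℂ : ℂ
  0ℂ = 0# +i 0#
  1ℂ = 1# +i 0#

  fromℝ : Carrier → ℂ
  fromℝ x = x +i 0#

  infixl 6 _+ℂ_ _-ℂ_
  infixl 7 _*ℂ_
  infixr 8 _^ℂ_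
  _+ℂ_ _-ℂ_ _*ℂ_ : ℂ → ℂ → ℂ
  (a +i b) +ℂ (a′ +i b′) = (a + a′) +i (b + b′)
  (a +i b) -ℂ (a′ +i b′) = (a - a′) +i (b - b′)
  (a +i b) *ℂ (a′ +i b′) = (a * a′ - b * b′) +i (a * b′ + b * a′)

  _^ℂ_ : ℂ → ℕ → ℂ
  z ^ℂ zero  = 1ℂ
  z ^ℂ suc n = z *ℂ (z ^ℂ n)

  ∣_∣ℂ : ℂ → Carrier
  ∣ z ∣ℂ = √ (re z * re z + im z * im z)

  ClosedDisc : Carrier → ℂ → Set ℓ₂
  ClosedDisc R z = ∣ z ∣ℂ ≤ R

  partialSumℂ : (ℕ → ℂ) → ℕ → ℂ
  partialSumℂ a zero    = 0ℂ
  partialSumℂ a (suc n) = partialSumℂ a n +ℂ a n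

  AbsolutelyConvergent : (ℕ → ℂ) → Set (c ⊔ˡ ℓ₂)
  AbsolutelyConvergent a = ∃[ L ] ConvergesTo (partialSum (λ n → ∣ a n ∣ℂ)) L

  UniformlyConvergentOn : ∀ {d} → (ℂ → Set d) → (ℕ → ℂ → ℂ) → Set (c ⊔ˡ ℓ₂ ⊔ˡ d)
  UniformlyConvergentOn D a =
    Σ (∀ z → D z → ℂ) λ S →
      ∀ ε → 0# < ε → ∃[ N ] (∀ n → N ℕ.≤ n → ∀ z (z∈D : D z) →
        ∣ partialSumℂ (λ k → a k z) n -ℂ S z z∈D ∣ℂ < ε)


module RationalFunctions {c ℓ₁ ℓ₂} (ℝ : RealField c ℓ₁ ℓ₂) where
  open RealField ℝ
  open RealFieldProperties ℝ
  open RingProperties (CommutativeRing.ring commutativeRing) using (-0#≈0#)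
  open SetoidReasoning setoid

  -- Coefficient lists, constant term first: a ∷ p stands for a + w p(w).
  Poly : Set c
  Poly = List Carrier

  infixl 6 _⊕_ _⊖_
  infixl 7 _⊗_ _⊙_

  _⊙_ : Carrier → Poly → Poly
  a ⊙ p = map (a *_) p

  _⊕_ _⊖_ _⊗_ : Poly → Poly → Poly
  []      ⊕ q       = q
  (a ∷ p) ⊕ []      = a ∷ p
  (a ∷ p) ⊕ (b ∷ q) = (a + b) ∷ (p ⊕ q)

  p ⊖ q = p ⊕ (- 1#) ⊙ q

  []      ⊗ q = []
  (a ∷ p) ⊗ q = (a ⊙ q) ⊕ (0# ∷ (p ⊗ q))

  1ₚ : Poly
  1ₚ = 1# ∷ []

  -- (a + w p)′ = p + w p′
  derivative : Poly → Poly
  derivative []      = []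
  derivative (a ∷ p) = p ⊕ (0# ∷ derivative p)

  eval : Poly → Carrier → Carrier
  eval []      x = 0#
  eval (a ∷ p) x = a + x * eval p x

  coeff : Poly → ℕ → Carrier
  coeff []      i       = 0#
  coeff (a ∷ p) zero    = a
  coeff (a ∷ p) (suc i) = coeff p i

  coeff₀≈eval : ∀ p → coeff p 0 ≈ eval p 0#
  coeff₀≈eval []      = refl
  coeff₀≈eval (a ∷ p) = sym (trans (+-congˡ (zeroˡ _)) (+-identityʳ a))

  +-interchange : ∀ a b x y → (a + b) + (x + y) ≈ (a + x) + (b + y)
  +-interchange a b x y = begin
    (a + b) + (x + y) ≈⟨ +-assoc a b _ ⟩
    a + (b + (x + y)) ≈⟨ +-congˡ (+-assoc b x y) ⟨
    a + ((b + x) + y) ≈⟨ +-congˡ (+-congʳ (+-comm b x)) ⟩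
    a + ((x + b) + y) ≈⟨ +-congˡ (+-assoc x b y) ⟩
    a + (x + (b + y)) ≈⟨ +-assoc a x _ ⟨
    (a + x) + (b + y) ∎

  eval-⊕ : ∀ p q x → eval (p ⊕ q) x ≈ eval p x + eval q x
  eval-⊕ []      q       x = sym (+-identityˡ _)
  eval-⊕ (a ∷ p) []      x = sym (+-identityʳ _)
  eval-⊕ (a ∷ p) (b ∷ q) x = begin
    (a + b) + x * eval (p ⊕ q) x           ≈⟨ +-congˡ (*-congˡ (eval-⊕ p q x)) ⟩
    (a + b) + x * (eval p x + eval q x)     ≈⟨ +-congˡ (distribˡ x _ _) ⟩
    (a + b) + (x * eval p x + x * eval q x) ≈⟨ +-interchange a b _ _ ⟩
    (a + x * eval p x) + (b + x * eval q x) ∎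

  *-leftSwap : ∀ a b y → a * (b * y) ≈ b * (a * y)
  *-leftSwap a b y = begin
    a * (b * y) ≈⟨ *-assoc a b y ⟨
    a * b * y   ≈⟨ *-congʳ (*-comm a b) ⟩
    b * a * y   ≈⟨ *-assoc b a y ⟩
    b * (a * y) ∎

  eval-⊙ : ∀ a p x → eval (a ⊙ p) x ≈ a * eval p x
  eval-⊙ a []      x = sym (zeroʳ a)
  eval-⊙ a (b ∷ p) x = begin
    a * b + x * eval (a ⊙ p) x ≈⟨ +-congˡ (*-congˡ (eval-⊙ a p x)) ⟩
    a * b + x * (a * eval p x) ≈⟨ +-congˡ (*-leftSwap x a _) ⟩
    a * b + a * (x * eval p x) ≈⟨ distribˡ a b _ ⟨
    a * (b + x * eval p x)     ∎

  eval-⊗ : ∀ p q x → eval (p ⊗ q) x ≈ eval p x * eval q x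
  eval-⊗ []      q x = sym (zeroˡ _)
  eval-⊗ (a ∷ p) q x = begin
    eval ((a ⊙ q) ⊕ (0# ∷ (p ⊗ q))) x         ≈⟨ eval-⊕ (a ⊙ q) (0# ∷ (p ⊗ q)) x ⟩
    eval (a ⊙ q) x + (0# + x * eval (p ⊗ q) x) ≈⟨ +-cong (eval-⊙ a q x) (+-identityˡ _) ⟩
    a * eval q x + x * eval (p ⊗ q) x          ≈⟨ +-congˡ (*-congˡ (eval-⊗ p q x)) ⟩
    a * eval q x + x * (eval p x * eval q x)   ≈⟨ +-congˡ (*-assoc x _ _) ⟨
    a * eval q x + x * eval p x * eval q x     ≈⟨ distribʳ _ a _ ⟨
    (a + x * eval p x) * eval q x              ∎

  eval-⊗#0 : ∀ p q x → eval p x # 0# → eval q x # 0# → eval (p ⊗ q) x # 0#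
  eval-⊗#0 p q x p#0 q#0 = #-congʳ (sym (eval-⊗ p q x)) (x#0y#0→xy#0 p#0 q#0)

  productOver : ∀ {a} {A : Set a} → List A → (A → Poly) → Poly
  productOver xs f = foldr (λ x p → f x ⊗ p) 1ₚ xs

  productOver#0 : ∀ {a} {A : Set a} (xs : List A) (f : A → Poly) x →
                  (∀ i → eval (f i) x # 0#) → eval (productOver xs f) x # 0#
  productOver#0 []       f x f#0 =
    #-congʳ (sym (trans (+-congˡ (zeroʳ x)) (+-identityʳ 1#))) 1#0
  productOver#0 (i ∷ xs) f x f#0 =
    eval-⊗#0 (f i) _ x (f#0 i) (productOver#0 xs f x f#0)

  -- A polynomial over an infinite field is nonzero iff it takes a nonzero
  -- value somewhere.
  record RationalFunction : Set (c ⊔ˡ ℓ₂) where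
    constructor fraction
    field
      num     : Poly
      den     : Poly
      den-#0  : ∃[ x ] eval den x # 0#
  open RationalFunction public

  RegularAt : Carrier → RationalFunction → Set ℓ₂
  RegularAt x f = eval (den f) x # 0#

  valueAt : ∀ x f → RegularAt x f → Carrier
  valueAt x f f-reg = eval (num f) x * inv (eval (den f) x) f-reg

  -- (p / q)′ = (p′ q - p q′) / q²
  ∂_ : RationalFunction → RationalFunction
  ∂ fraction p q (x , q#0) =
    fraction (derivative p ⊗ q ⊖ p ⊗ derivative q) (q ⊗ q) (x , eval-⊗#0 q q x q#0 q#0)

  ∂^ : ℕ → RationalFunction → RationalFunction
  ∂^ zero    f = f
  ∂^ (suc n) f = ∂ (∂^ n f)

  ∂^-regular : ∀ n f {x} → RegularAt x f → RegularAt x (∂^ n f)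
  ∂^-regular zero    f f-reg = f-reg
  ∂^-regular (suc n) f f-reg =
    eval-⊗#0 (den (∂^ n f)) (den (∂^ n f)) _ (∂^-regular n f f-reg) (∂^-regular n f f-reg)

  PowerSeries : Set c
  PowerSeries = ℕ → Carrier

  infix 4 _≋_
  _≋_ : Rel PowerSeries ℓ₁
  f ≋ g = ∀ n → f n ≈ g n

  infixr 7 _∙_
  _∙_ : Carrier → PowerSeries → PowerSeries
  (a ∙ f) n = a * f n

  -- Multiplication by the variable.
  τ∙_ : PowerSeries → PowerSeries
  (τ∙ f) zero    = 0#
  (τ∙ f) (suc n) = f n

  -- Substitution of a τ for the variable.
  _[_τ] : PowerSeries → Carrier → PowerSeries
  (f [ a τ]) n = a ^ n * f n

  -- The quotient p / q of power series, q having constant term invertible, by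
  -- long division: with r = p 0 / q 0, it is r + w (((p - r q) / w) / q).
  divide : (p q : PowerSeries) → q 0 # 0# → PowerSeries
  divide p q q#0 zero    = p 0 * inv (q 0) q#0
  divide p q q#0 (suc n) =
    divide (λ i → p (suc i) - p 0 * inv (q 0) q#0 * q (suc i)) q q#0 n

  expansion : ∀ f → RegularAt 0# f → PowerSeries
  expansion f f-reg =
    divide (coeff (num f)) (coeff (den f)) (#-congʳ (sym (coeff₀≈eval (den f))) f-reg)


select : ∀ {a p} {A : Set a} {P : Pred A p} → Decidable P → List A → List (Σ A P)
select P? []       = []
select P? (x ∷ xs) with P? x
... | yes px = (x , px) ∷ select P? xs
... | no  _  = select P? xs


module Verlinde {c ℓ₁ ℓ₂} (ℝ : RealField c ℓ₁ ℓ₂) (T : Trigonometry ℝ)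
                (m : ℕ) (3≤m : 3 ℕ.≤ m) where
  open RealField ℝ
  open RealFieldProperties ℝ
  open RationalFunctions ℝ
  open Trigonometry T

  instance
    m-nonZero : NonZero m
    m-nonZero = ℕ.>-nonZero (ℕₚ.≤-trans (s≤s z≤n) 3≤m)

  ℤ/m : Set
  ℤ/m = Fin m

  infixl 6 _+ₘ_
  _+ₘ_ : ℤ/m → ℤ/m → ℤ/m
  a +ₘ b = (toℕ a ℕ.+ toℕ b) mod m

  IsZero : ℤ/m → Set
  IsZero a = toℕ a ≡ 0

  isZero? : Decidable IsZero
  isZero? a = toℕ a ℕₚ.≟ 0

  -- sin (π a / m) for the representative 0 ≤ a < m; only even powers of it are
  -- used, which do not depend on the representative.
  sinπ/m : ℤ/m → Carrier
  sinπ/m a = sin (π * fromℕ (toℕ a) /ℕ m)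

  sinπ/m#0 : ∀ {a} → ¬ IsZero a → sinπ/m a # 0#
  sinπ/m#0 {a} a≢0 = π-first _
    (/ℕ-pos π-pos m (toℕ a) (ℕₚ.n≢0⇒n>0 a≢0))
    (/ℕ-below π-pos m (toℕ a) (toℕ<n a))

  Triple : Pred (ℤ/m × ℤ/m × ℤ/m) _
  Triple (j , ℓ , k) = (¬ IsZero j × ¬ IsZero ℓ × ¬ IsZero k) × IsZero (j +ₘ ℓ +ₘ k)

  triple? : Decidable Triple
  triple? (j , ℓ , k) =
    (¬? (isZero? j) ×-dec ¬? (isZero? ℓ) ×-dec ¬? (isZero? k)) ×-dec isZero? (j +ₘ ℓ +ₘ k)

  triples : List (Σ _ Triple)
  triples = select triple?
    (cartesianProduct (allFin m) (cartesianProduct (allFin m) (allFin m)))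

  sineProduct : ℤ/m × ℤ/m × ℤ/m → Carrier
  sineProduct (j , ℓ , k) = fromℕ 8 * sinπ/m j * sinπ/m ℓ * sinπ/m k

  sineProduct#0 : ∀ {t} → Triple t → sineProduct t # 0#
  sineProduct#0 ((j≢0 , ℓ≢0 , k≢0) , _) =
    x#0y#0→xy#0 (x#0y#0→xy#0 (x#0y#0→xy#0 (fromℕ#0 8) (sinπ/m#0 j≢0)) (sinπ/m#0 ℓ≢0)) (sinπ/m#0 k≢0)

  V : ℕ → Carrier
  V n = fromℕ 3 ^ n * fromℕ m ^ (2 ℕ.* n) *
        sumOver triples λ (t , t∈) → inv (sineProduct t) (sineProduct#0 t∈) ^ (2 ℕ.* n)

  G : Set
  G = ℤ/m × ℤ/m

  eigenvalue : G → Carrier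
  eigenvalue (a , b) =
    fromℕ 16 * sinπ/m a ^ 2 * sinπ/m b ^ 2 * sinπ/m (a +ₘ b) ^ 2

  Z : Pred G _
  Z (a , b) = IsZero a ⊎ IsZero b ⊎ IsZero (a +ₘ b)

  G∖Z : Set
  G∖Z = Σ G λ j → ¬ Z j

  allG∖Z : List G∖Z
  allG∖Z = select
    (λ (a , b) → ¬? (isZero? a ⊎-dec isZero? b ⊎-dec isZero? (a +ₘ b)))
    (cartesianProduct (allFin m) (allFin m))

  λₘ : G∖Z → Carrier
  λₘ (j , _) = eigenvalue j

  λₘ#0 : ∀ j → λₘ j # 0#
  λₘ#0 (_ , j∉Z) =
    x#0y#0→xy#0 (x#0y#0→xy#0 (x#0y#0→xy#0 (fromℕ#0 16)
      (^#0 2 (sinπ/m#0 λ a≡0 → j∉Z (inj₁ a≡0))))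
      (^#0 2 (sinπ/m#0 λ b≡0 → j∉Z (inj₂ (inj₁ b≡0)))))
      (^#0 2 (sinπ/m#0 λ s≡0 → j∉Z (inj₂ (inj₂ s≡0))))

  ζ : ℕ → Carrier
  ζ s = sumOver allG∖Z λ j → inv (λₘ j) (λₘ#0 j) ^ s

  linearFactor : G∖Z → Poly
  linearFactor j = λₘ j ∷ - 1# ∷ []

  H : Poly
  H = productOver allG∖Z linearFactor

  H₀#0 : eval H 0# # 0#
  H₀#0 = productOver#0 allG∖Z linearFactor 0# λ j →
    #-congʳ (sym (trans (+-congˡ (zeroˡ _)) (+-identityʳ _))) (λₘ#0 j)

  m²#0 : fromℕ m ^ 2 # 0#
  m²#0 = ^#0 2 (fromℕ#0 m)

  F : RationalFunction
  F = fraction (- inv (fromℕ m ^ 2) m²#0 ⊙ derivative H) H (0# , H₀#0)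

  cₘ : Carrier
  cₘ = fromℕ 3 * fromℕ m ^ 2 /ℕ 4

  cₘ#0 : cₘ # 0#
  cₘ#0 = x#0y#0→xy#0 (x#0y#0→xy#0 (fromℕ#0 3) m²#0) (inv#0 _ (fromℕ#0 4))

  -- (1 , 1) lies outside Z because m ≥ 3.
  [1,1] : G∖Z
  [1,1] = (one , one) , λ
    { (inj₁ p)        → one≢0 p
    ; (inj₂ (inj₁ p)) → one≢0 p
    ; (inj₂ (inj₂ p)) → two≢0 p }
    where
    1<m : 1 ℕ.< m
    1<m = ℕₚ.≤-trans (s≤s (s≤s z≤n)) 3≤m

    one : ℤ/m
    one = fromℕ< 1<m

    one≢0 : ¬ IsZero one
    one≢0 p with () ← ≡.trans (≡.sym (toℕ-fromℕ< 1<m)) p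

    two≡ : toℕ (one +ₘ one) ≡ 2
    two≡ = ≡.trans (toℕ-fromℕ< (m%n<n (toℕ one ℕ.+ toℕ one) m))
      (≡.trans (≡.cong (λ i → (i ℕ.+ i) ℕ.% m) (toℕ-fromℕ< 1<m)) (m<n⇒m%n≡m 3≤m))

    two≢0 : ¬ IsZero (one +ₘ one)
    two≢0 p with () ← ≡.trans (≡.sym two≡) p

  minEigenvalue : Carrier
  minEigenvalue = foldr (λ j μ → λₘ j ⊓ μ) (λₘ [1,1]) allG∖Z

  -- Coefficients of ∑_{n ≥ 1} V n τⁿ.
  verlindeSeries : PowerSeries
  verlindeSeries zero      = 0#
  verlindeSeries n@(suc _) = V n

{-# OPTIONS --safe #-}

-- For a triple with j + ℓ + k ≡ 0, the reflection formula sin² (π - x) = sin² x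
-- turns sin² (π k / m) into sin² (π (j + ℓ) / m), so the square of the sine
-- product is 4 λ(j , ℓ) and V n = (3 m² / 4)ⁿ ζ n.
--
-- The reflection formula comes from the addition theorem for sine: the Taylor
-- series of both sides, as formal power series in t with x t for x, solve the
-- same linear differential equation, and geometrically bounded series may be
-- multiplied before they are summed at t = 1.
--
-- Since - H′ / H = ∑ 1 / (λ - w), expanding each summand in a geometric series
-- shows that the coefficient of wⁿ in m² F is ζ (n + 1); this coefficient is also
-- the n-th derivative at 0 divided by n!.
--
-- Finally V n ≤ #(G ∖ Z) (cₘ / min λ)ⁿ, so on the given disc the series is
-- dominated by a geometric one.
module Submission where

open import Defs
open import Data.Nat as ℕ using (ℕ; _!)
open import Data.Nat.Properties using (_!≢0)
open import Data.Product using (_×_)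

open import Algebra.Bundles using (CommutativeRing; RawRing)
import Algebra.Properties.AbelianGroup as AbelianGroupProperties
import Algebra.Properties.CommutativeSemiring.Exp as CommutativeSemiringExp
import Algebra.Properties.Ring as RingProperties
import Algebra.Properties.Semiring.Exp as SemiringExp
import Algebra.Properties.Semiring.Mult as SemiringMult
import Algebra.Solver.Ring
open import Algebra.Solver.Ring.AlmostCommutativeRing
  using (fromCommutativeRing; _-Raw-AlmostCommutative⟶_)
open import Data.Fin.Base as Fin using (Fin; toℕ; fromℕ<)
open import Data.Fin.Properties as Finₚ using (toℕ<n; toℕ-fromℕ<)
open import Data.Integer.Base as ℤ using (ℤ; +_; -[1+_])
import Data.Integer.Properties as ℤₚ
open import Data.List.Base
  using (List; []; _∷_; foldr; map; length; _++_; cartesianProduct; tabulate; allFin)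
open import Data.Maybe.Base as Maybe using (Maybe)
open import Data.Nat using (zero; suc)
open import Data.Nat.DivMod using (_%_; m<n⇒m%n≡m; m%n<n; m≤n⇒[n∸m]%m≡n%m; n%n≡0)
import Data.Nat.Properties as ℕₚ
open import Data.Product using (Σ; ∃-syntax; _,_; proj₁; proj₂)
open import Data.Sum.Base using (_⊎_; inj₁; inj₂; [_,_]′)
open import Function.Base using (_∘_; flip; id)
import Relation.Binary.Reasoning.Base.Triple as TripleReasoning
import Relation.Binary.Reasoning.Setoid as SetoidReasoning
open import Relation.Binary.PropositionalEquality as ≡ using (_≡_; _≢_)
open import Relation.Binary.Structures using (IsPreorder; IsStrictPartialOrder)
open import Relation.Nullary using (¬_; Dec; yes; no; contradiction)
open import Relation.Nullary.Decidable using (¬?; _⊎-dec_; dec⇒maybe)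
open import Relation.Unary using (Pred; Decidable)

-- The order is axiomatized through apartness, and this shapes every estimate: signs cannot be
-- decided, `_≤_` is a negated `_<_`, and a case split needs a strict gap against which a third
-- point is placed. Inequalities are therefore proved by exhibiting a nonnegative difference or by
-- refuting the strict converse, and limits come with explicit error bounds. Rational functions are
-- formal fractions, so their derivatives and expansions involve no limits. A series r and a
-- fraction p / q are tied together by the cross-multiplied equation r q = p; long division,
-- differentiation and the logarithmic derivative of `H` all meet in this form. Analysis enters only
-- for the sine and for the final disc. The terms of the sine series decay faster than any geometric
-- rate, so the rate may be chosen freely. It is taken to be 1/4, because then the error of a
-- product of partial sums obeys an induction whose constants close up exactly at the slower rate
-- 1/2.

-- Ring solver with integer coefficients.

module IntegerSolver {c ℓ} (R : CommutativeRing c ℓ) where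
  open CommutativeRing R
  open RingProperties ring
  open AbelianGroupProperties +-abelianGroup using (⁻¹-∙-comm)
  open SemiringMult semiring using (×-homo-+; ×1-homo-*; ×-homo-1) renaming (_×_ to _·_)
  open SetoidReasoning setoid

  private
    ⟦_⟧ℤ : ℤ → Carrier
    ⟦ + n ⟧ℤ      = n · 1#
    ⟦ -[1+ n ] ⟧ℤ = - (suc n · 1#)

    neg-homo : ∀ i → ⟦ ℤ.- i ⟧ℤ ≈ - ⟦ i ⟧ℤ
    neg-homo (+ zero)  = sym -0#≈0#
    neg-homo (+ suc n) = refl
    neg-homo -[1+ n ]  = sym (-‿involutive _)

    ⊖-homo : ∀ m n → ⟦ m ℤ.⊖ n ⟧ℤ ≈ m · 1# - n · 1#
    ⊖-homo zero    zero    = sym (-‿inverseʳ 0#)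
    ⊖-homo zero    (suc n) = sym (+-identityˡ _)
    ⊖-homo (suc m) zero    = sym (trans (+-congˡ -0#≈0#) (+-identityʳ _))
    ⊖-homo (suc m) (suc n) = begin
      ⟦ suc m ℤ.⊖ suc n ⟧ℤ               ≡⟨ ≡.cong ⟦_⟧ℤ (ℤₚ.[1+m]⊖[1+n]≡m⊖n m n) ⟩
      ⟦ m ℤ.⊖ n ⟧ℤ                       ≈⟨ ⊖-homo m n ⟩
      m · 1# - n · 1#                     ≈⟨ +-identityˡ _ ⟨
      0# + (m · 1# - n · 1#)              ≈⟨ +-congʳ (-‿inverseʳ 1#) ⟨
      (1# - 1#) + (m · 1# - n · 1#)       ≈⟨ +-assoc _ _ _ ⟩
      1# + (- 1# + (m · 1# - n · 1#))     ≈⟨ +-congˡ (+-assoc _ _ _) ⟨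
      1# + ((- 1# + m · 1#) - n · 1#)     ≈⟨ +-congˡ (+-congʳ (+-comm _ _)) ⟩
      1# + ((m · 1# - 1#) - n · 1#)       ≈⟨ +-congˡ (+-assoc _ _ _) ⟩
      1# + (m · 1# + (- 1# - n · 1#))     ≈⟨ +-assoc _ _ _ ⟨
      suc m · 1# + (- 1# - n · 1#)        ≈⟨ +-congˡ (⁻¹-∙-comm _ _) ⟩
      suc m · 1# - suc n · 1#             ∎

    +-homo : ∀ i j → ⟦ i ℤ.+ j ⟧ℤ ≈ ⟦ i ⟧ℤ + ⟦ j ⟧ℤ
    +-homo (+ m)    (+ n)    = ×-homo-+ 1# m n
    +-homo (+ m)    -[1+ n ] = ⊖-homo m (suc n)
    +-homo -[1+ m ] (+ n)    = trans (⊖-homo n (suc m)) (+-comm _ _)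
    +-homo -[1+ m ] -[1+ n ] = begin
      - (suc (suc (m ℕ.+ n)) · 1#)   ≡⟨ ≡.cong (λ k → - (k · 1#)) (ℕₚ.+-suc (suc m) n) ⟨
      - ((suc m ℕ.+ suc n) · 1#)     ≈⟨ -‿cong (×-homo-+ 1# (suc m) (suc n)) ⟩
      - (suc m · 1# + suc n · 1#)    ≈⟨ ⁻¹-∙-comm _ _ ⟨
      - (suc m · 1#) - suc n · 1#    ∎

    +*-homo : ∀ m j → ⟦ + m ℤ.* j ⟧ℤ ≈ m · 1# * ⟦ j ⟧ℤ
    +*-homo m (+ n) = trans (reflexive (≡.cong ⟦_⟧ℤ (≡.sym (ℤₚ.pos-* m n)))) (×1-homo-* m n)
    +*-homo m -[1+ n ] = begin
      ⟦ + m ℤ.* -[1+ n ] ⟧ℤ        ≡⟨ ≡.cong ⟦_⟧ℤ (ℤₚ.neg-distribʳ-* (+ m) (+ suc n)) ⟨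
      ⟦ ℤ.- (+ m ℤ.* + suc n) ⟧ℤ   ≈⟨ neg-homo (+ m ℤ.* + suc n) ⟩
      - ⟦ + m ℤ.* + suc n ⟧ℤ       ≈⟨ -‿cong (+*-homo m (+ suc n)) ⟩
      - (m · 1# * (suc n · 1#))     ≈⟨ -‿distribʳ-* _ _ ⟩
      m · 1# * - (suc n · 1#)       ∎

    *-homo : ∀ i j → ⟦ i ℤ.* j ⟧ℤ ≈ ⟦ i ⟧ℤ * ⟦ j ⟧ℤ
    *-homo (+ m)    j = +*-homo m j
    *-homo -[1+ m ] j = begin
      ⟦ -[1+ m ] ℤ.* j ⟧ℤ          ≡⟨ ≡.cong ⟦_⟧ℤ (ℤₚ.neg-distribˡ-* (+ suc m) j) ⟨
      ⟦ ℤ.- (+ suc m ℤ.* j) ⟧ℤ     ≈⟨ neg-homo (+ suc m ℤ.* j) ⟩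
      - ⟦ + suc m ℤ.* j ⟧ℤ         ≈⟨ -‿cong (+*-homo (suc m) j) ⟩
      - (suc m · 1# * ⟦ j ⟧ℤ)      ≈⟨ -‿distribˡ-* _ _ ⟩
      - (suc m · 1#) * ⟦ j ⟧ℤ      ∎

    ℤ-rawRing : RawRing _ _
    ℤ-rawRing = record
      { Carrier = ℤ; _≈_ = _≡_; _+_ = ℤ._+_; _*_ = ℤ._*_; -_ = ℤ.-_; 0# = ℤ.0ℤ; 1# = ℤ.1ℤ }

    -- 1 · 1# is 1# + 0#, but con 1 should denote 1# itself.
    ⟦_⟧ : ℤ → Carrier
    ⟦ + 1 ⟧ = 1#
    ⟦ i ⟧   = ⟦ i ⟧ℤ

    ⟦⟧≈⟦⟧ℤ : ∀ i → ⟦ i ⟧ ≈ ⟦ i ⟧ℤ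
    ⟦⟧≈⟦⟧ℤ (+ zero)        = refl
    ⟦⟧≈⟦⟧ℤ (+ suc zero)    = sym (×-homo-1 1#)
    ⟦⟧≈⟦⟧ℤ (+ suc (suc n)) = refl
    ⟦⟧≈⟦⟧ℤ -[1+ n ]        = refl

    homomorphism : ℤ-rawRing -Raw-AlmostCommutative⟶ fromCommutativeRing R
    homomorphism = record
      { ⟦_⟧    = ⟦_⟧
      ; +-homo = λ i j → trans (⟦⟧≈⟦⟧ℤ (i ℤ.+ j)) (trans (+-homo i j) (sym (+-cong (⟦⟧≈⟦⟧ℤ i) (⟦⟧≈⟦⟧ℤ j))))
      ; *-homo = λ i j → trans (⟦⟧≈⟦⟧ℤ (i ℤ.* j)) (trans (*-homo i j) (sym (*-cong (⟦⟧≈⟦⟧ℤ i) (⟦⟧≈⟦⟧ℤ j))))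
      ; -‿homo = λ i → trans (⟦⟧≈⟦⟧ℤ (ℤ.- i)) (trans (neg-homo i) (-‿cong (sym (⟦⟧≈⟦⟧ℤ i))))
      ; 0-homo = refl
      ; 1-homo = refl
      }

    _coeff≟_ : ∀ i j → Maybe (⟦ i ⟧ ≈ ⟦ j ⟧)
    i coeff≟ j = Maybe.map (λ i≡j → reflexive (≡.cong ⟦_⟧ i≡j)) (dec⇒maybe (i ℤₚ.≟ j))

  open Algebra.Solver.Ring ℤ-rawRing (fromCommutativeRing R) homomorphism _coeff≟_ public
    using (solve; _:=_; con; _:+_; _:*_; _:-_; :-_)

-- Order, absolute value and inverses in a constructive ordered field.

module OrderedField {c ℓ₁ ℓ₂} (ℝ : RealField c ℓ₁ ℓ₂) where
  open RealField ℝ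
  open RealFieldProperties ℝ
  open RationalFunctions ℝ using (*-leftSwap)
  open IntegerSolver commutativeRing public
  private module < = IsStrictPartialOrder isStrictPartialOrder

  -- The substitute for trichotomy: cotransitivity of `_#_` puts z apart from x or from y, and
  -- `#⇒<⊎>` turns this apartness into an order.
  <-cotrans : ∀ {x y} → x < y → ∀ z → x < z ⊎ z < y
  <-cotrans x<y z with #-cotrans (<⇒# x<y) z
  ... | inj₁ x#z with #⇒<⊎> x#z
  ...   | inj₁ x<z = inj₁ x<z
  ...   | inj₂ z<x = inj₂ (<.trans z<x x<y)
  <-cotrans x<y z | inj₂ z#y with #⇒<⊎> z#y
  ...   | inj₁ z<y = inj₂ z<y
  ...   | inj₂ y<z = inj₁ (<.trans x<y y<z)

  <⇒≤ : ∀ {x y} → x < y → x ≤ y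
  <⇒≤ = <.asym

  ≤-reflexive : ∀ {x y} → x ≈ y → x ≤ y
  ≤-reflexive x≈y = <.irrefl (sym x≈y)

  ≤-refl : ∀ {x} → x ≤ x
  ≤-refl = ≤-reflexive refl

  -- Apartness is tight, and if x and y were apart, one of the two strict orders would hold, against
  -- a hypothesis.
  ≤-antisym : ∀ {x y} → x ≤ y → y ≤ x → x ≈ y
  ≤-antisym x≤y y≤x = proj₁ (tight _ _) λ x#y → [ y≤x , x≤y ]′ (#⇒<⊎> x#y)

  ≤-trans : ∀ {x y z} → x ≤ y → y ≤ z → x ≤ z
  ≤-trans {y = y} x≤y y≤z z<x = [ y≤z , x≤y ]′ (<-cotrans z<x y)

  <-≤-trans : ∀ {x y z} → x < y → y ≤ z → x < z
  <-≤-trans x<y y≤z with <-cotrans x<y _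
  ... | inj₁ x<z = x<z
  ... | inj₂ z<y = contradiction z<y y≤z

  ≤-<-trans : ∀ {x y z} → x ≤ y → y < z → x < z
  ≤-<-trans x≤y y<z with <-cotrans y<z _
  ... | inj₁ y<x = contradiction y<x x≤y
  ... | inj₂ x<z = x<z

  ≤-isPreorder : IsPreorder _≈_ _≤_
  ≤-isPreorder = record { isEquivalence = isEquivalence ; reflexive = ≤-reflexive ; trans = ≤-trans }

  module ≤-Reasoning = TripleReasoning ≤-isPreorder
    <.asym <.trans <.<-resp-≈ <⇒≤ <-≤-trans ≤-<-trans

  <-trans : ∀ {x y z} → x < y → y < z → x < z
  <-trans = <.trans

  <-resp : ∀ {x x′ y y′} → x ≈ x′ → y ≈ y′ → x < y → x′ < y′
  <-resp x≈x′ y≈y′ = <.<-respˡ-≈ x≈x′ ∘ <.<-respʳ-≈ y≈y′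

  ≤-resp : ∀ {x x′ y y′} → x ≈ x′ → y ≈ y′ → x ≤ y → x′ ≤ y′
  ≤-resp x≈x′ y≈y′ x≤y = x≤y ∘ <-resp (sym y≈y′) (sym x≈x′)

  <-byDifference : ∀ {x y d} → 0# < d → x + d ≈ y → x < y
  <-byDifference {x} 0<d = λ eq → <-resp (+-identityʳ x) eq (+-monoʳ-< x 0<d)

  0<difference : ∀ {x y} → x < y → 0# < y - x
  0<difference {x} {y} x<y =
    <-resp (-‿inverseˡ x) (+-comm _ _) (+-monoʳ-< (- x) x<y)

  -- The usual route to an inequality: the difference is written as a visibly nonnegative d, and the
  -- remaining equation goes to the ring solver.
  ≤-byDifference : ∀ {x y d} → 0# ≤ d → x + d ≈ y → x ≤ y
  ≤-byDifference {x} {y} {d} 0≤d eq y<x = 0≤d (<-resp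
    (trans (+-congˡ (sym eq)) (solve 2 (λ x d → (:- x) :+ (x :+ d) := d) refl x d))
    (-‿inverseˡ x) (+-monoʳ-< (- x) y<x))

  0≤difference : ∀ {x y} → x ≤ y → 0# ≤ y - x
  0≤difference {x} {y} x≤y y-x<0 = x≤y (<-resp
    (solve 2 (λ x y → x :+ (y :- x) := y) refl x y) (+-identityʳ x) (+-monoʳ-< x y-x<0))

  0≤1 : 0# ≤ 1#
  0≤1 = <⇒≤ 0<1

  +-nonneg : ∀ {x y} → 0# ≤ x → 0# ≤ y → 0# ≤ x + y
  +-nonneg {x} {y} 0≤x 0≤y = ≤-trans 0≤x (≤-byDifference 0≤y refl)

  +-pos : ∀ {x y} → 0# < x → 0# < y → 0# < x + y
  +-pos 0<x 0<y = <-trans 0<x (<-byDifference 0<y refl)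

  -- A nonzero product has nonzero factors, so the sign of each factor can be
  -- decided when the product is assumed to be negative.
  *-nonneg : ∀ {x y} → 0# ≤ x → 0# ≤ y → 0# ≤ x * y
  *-nonneg {x} {y} 0≤x 0≤y xy<0 = <.asym xy<0 (*-pos (positive 0≤x x#0) (positive 0≤y y#0))
    where
    positive : ∀ {z} → 0# ≤ z → z # 0# → 0# < z
    positive 0≤z z#0 = [ flip contradiction 0≤z , (λ 0<z → 0<z) ]′ (#⇒<⊎> z#0)
    w = inv (x * y) (<⇒# xy<0)
    xyw = inv-inverseʳ (x * y) (<⇒# xy<0)
    x#0 : x # 0#
    x#0 = invertible⇒# (y * w ,
      trans (solve 3 (λ x y w → y :* w :* (x :- con ℤ.0ℤ) := x :* y :* w) refl x y w) xyw ,
      trans (solve 3 (λ x y w → (x :- con ℤ.0ℤ) :* (y :* w) := x :* y :* w) refl x y w) xyw)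
    y#0 : y # 0#
    y#0 = invertible⇒# (x * w ,
      trans (solve 3 (λ x y w → x :* w :* (y :- con ℤ.0ℤ) := x :* y :* w) refl x y w) xyw ,
      trans (solve 3 (λ x y w → (y :- con ℤ.0ℤ) :* (x :* w) := x :* y :* w) refl x y w) xyw)

  +-mono-≤ : ∀ {x x′ y y′} → x ≤ x′ → y ≤ y′ → x + y ≤ x′ + y′
  +-mono-≤ {x} {x′} {y} {y′} x≤x′ y≤y′ = ≤-byDifference
    (+-nonneg (0≤difference x≤x′) (0≤difference y≤y′))
    (solve 4 (λ x x′ y y′ → x :+ y :+ ((x′ :- x) :+ (y′ :- y)) := x′ :+ y′) refl x x′ y y′)

  +-mono-< : ∀ {x x′ y y′} → x < x′ → y < y′ → x + y < x′ + y′
  +-mono-< {x} {x′} {y} {y′} x<x′ y<y′ = <-byDifference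
    (+-pos (0<difference x<x′) (0<difference y<y′))
    (solve 4 (λ x x′ y y′ → x :+ y :+ ((x′ :- x) :+ (y′ :- y)) := x′ :+ y′) refl x x′ y y′)

  *-monoˡ-≤ : ∀ {x y y′} → 0# ≤ x → y ≤ y′ → x * y ≤ x * y′
  *-monoˡ-≤ {x} {y} {y′} 0≤x y≤y′ = ≤-byDifference
    (*-nonneg 0≤x (0≤difference y≤y′))
    (solve 3 (λ x y y′ → x :* y :+ x :* (y′ :- y) := x :* y′) refl x y y′)

  *-monoˡ-< : ∀ {x y y′} → 0# < x → y < y′ → x * y < x * y′
  *-monoˡ-< {x} {y} {y′} 0<x y<y′ = <-byDifference
    (*-pos 0<x (0<difference y<y′))
    (solve 3 (λ x y y′ → x :* y :+ x :* (y′ :- y) := x :* y′) refl x y y′)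

  *-mono-≤ : ∀ {x x′ y y′} → 0# ≤ x → 0# ≤ y′ → x ≤ x′ → y ≤ y′ → x * y ≤ x′ * y′
  *-mono-≤ 0≤x 0≤y′ x≤x′ y≤y′ = ≤-trans (*-monoˡ-≤ 0≤x y≤y′)
    (≤-resp (*-comm _ _) (*-comm _ _) (*-monoˡ-≤ 0≤y′ x≤x′))

  *-cancelˡ-< : ∀ {x y y′} → 0# < x → x * y < x * y′ → y < y′
  *-cancelˡ-< {x} {y} {y′} 0<x xy<xy′ = <-resp (cancel y) (cancel y′) (*-monoˡ-< (inv-pos x x#0 0<x) xy<xy′)
    where
    x#0 = pos⇒#0 0<x
    cancel : ∀ z → inv x x#0 * (x * z) ≈ z
    cancel z = trans (solve 3 (λ x z w → w :* (x :* z) := x :* w :* z) refl x z (inv x x#0))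
      (trans (*-congʳ (inv-inverseʳ x x#0)) (*-identityˡ z))

  *-cancelˡ-≤ : ∀ {x y y′} → 0# < x → x * y ≤ x * y′ → y ≤ y′
  *-cancelˡ-≤ 0<x xy≤xy′ y′<y = xy≤xy′ (*-monoˡ-< 0<x y′<y)

  -- If y < x, then y² ≤ x y < x², because x is then positive.
  square-cancel-≤ : ∀ {x y} → 0# ≤ y → x * x ≤ y * y → x ≤ y
  square-cancel-≤ {x} {y} 0≤y xx≤yy y<x = xx≤yy (≤-<-trans
    (≤-resp (*-comm _ _) refl (*-monoˡ-≤ 0≤y (<⇒≤ y<x)))
    (<-resp (*-comm _ _) refl (*-monoˡ-< (≤-<-trans 0≤y y<x) y<x)))

  -- The sign of x is unknown. But if x² < 0, then x cannot be negative, as (- x)² would be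
  -- positive; so x is nonnegative, and x² with it.
  0≤square : ∀ x → 0# ≤ x * x
  0≤square x xx<0 = *-nonneg 0≤x 0≤x xx<0
    where
    0≤x : 0# ≤ x
    0≤x x<0 = <.asym xx<0 (<-resp refl
      (solve 1 (λ x → (:- x) :* (:- x) := x :* x) refl x) (*-pos (neg⇒pos x<0) (neg⇒pos x<0)))

  fromℕ-nonneg : ∀ n → 0# ≤ fromℕ n
  fromℕ-nonneg zero    = ≤-refl
  fromℕ-nonneg (suc n) = <⇒≤ (fromℕ-pos (suc n))

  fromℕ-mono-≤ : ∀ {m n} → m ℕ.≤ n → fromℕ m ≤ fromℕ n
  fromℕ-mono-≤ {m} {n} m≤n = ≤-byDifference (fromℕ-nonneg (n ℕ.∸ m))
    (trans (sym (fromℕ-+ m (n ℕ.∸ m))) (reflexive (≡.cong fromℕ (ℕₚ.m+[n∸m]≡n m≤n))))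

  ^-nonneg : ∀ {x} n → 0# ≤ x → 0# ≤ x ^ n
  ^-nonneg zero    0≤x = 0≤1
  ^-nonneg (suc n) 0≤x = *-nonneg 0≤x (^-nonneg n 0≤x)

  ^-pos : ∀ {x} n → 0# < x → 0# < x ^ n
  ^-pos zero    0<x = 0<1
  ^-pos (suc n) 0<x = *-pos 0<x (^-pos n 0<x)

  ^-monoˡ-≤ : ∀ {x y} n → 0# ≤ x → x ≤ y → x ^ n ≤ y ^ n
  ^-monoˡ-≤ zero    0≤x x≤y = ≤-refl
  ^-monoˡ-≤ (suc n) 0≤x x≤y =
    *-mono-≤ 0≤x (^-nonneg n (≤-trans 0≤x x≤y)) x≤y (^-monoˡ-≤ n 0≤x x≤y)

  half : Carrier
  half = inv (fromℕ 2) (fromℕ#0 2)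

  half-pos : 0# < half
  half-pos = inv-pos _ (fromℕ#0 2) (fromℕ-pos 2)

  half+half≈1 : half + half ≈ 1#
  half+half≈1 = trans (solve 1 (λ h → h :+ h := con (+ 2) :* h) refl half) (inv-inverseʳ _ (fromℕ#0 2))

  halves : ∀ x → half * x + half * x ≈ x
  halves x = trans (sym (distribʳ x half half)) (trans (*-congʳ half+half≈1) (*-identityˡ x))

  half*-pos : ∀ {x} → 0# < x → 0# < half * x
  half*-pos = *-pos half-pos

  x≤∣x∣ : ∀ x → x ≤ ∣ x ∣
  x≤∣x∣ x = proj₁ (⊔-supremum x (- x))

  -x≤∣x∣ : ∀ x → - x ≤ ∣ x ∣
  -x≤∣x∣ x = proj₁ (proj₂ (⊔-supremum x (- x)))

  ∣∣-least : ∀ {x b} → x ≤ b → - x ≤ b → ∣ x ∣ ≤ b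
  ∣∣-least {x} = proj₂ (proj₂ (⊔-supremum x (- x))) _

  ∣∣-nonneg : ∀ x → 0# ≤ ∣ x ∣
  ∣∣-nonneg x ∣x∣<0 = <.irrefl refl (<-trans (neg⇒pos x<0) (≤-<-trans (-x≤∣x∣ x) ∣x∣<0))
    where
    x<0 : x < 0#
    x<0 = ≤-<-trans (x≤∣x∣ x) ∣x∣<0

  ∣∣-cong : ∀ {x y} → x ≈ y → ∣ x ∣ ≈ ∣ y ∣
  ∣∣-cong x≈y = ≤-antisym (le x≈y) (le (sym x≈y))
    where
    le : ∀ {x y} → x ≈ y → ∣ x ∣ ≤ ∣ y ∣
    le x≈y = ∣∣-least (≤-resp (sym x≈y) refl (x≤∣x∣ _)) (≤-resp (-‿cong (sym x≈y)) refl (-x≤∣x∣ _))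

  ∣∣-of-nonneg : ∀ {x} → 0# ≤ x → ∣ x ∣ ≈ x
  ∣∣-of-nonneg {x} 0≤x = ≤-antisym (∣∣-least ≤-refl (≤-byDifference (+-nonneg 0≤x 0≤x)
    (solve 1 (λ x → (:- x) :+ (x :+ x) := x) refl x))) (x≤∣x∣ x)

  ∣-∣ : ∀ x → ∣ - x ∣ ≤ ∣ x ∣
  ∣-∣ x = ∣∣-least (-x≤∣x∣ x) (≤-resp (solve 1 (λ x → x := :- (:- x)) refl x) refl (x≤∣x∣ x))

  ∣∣-+ : ∀ {x y a b} → ∣ x ∣ ≤ a → ∣ y ∣ ≤ b → ∣ x + y ∣ ≤ a + b
  ∣∣-+ {x} {y} ∣x∣≤a ∣y∣≤b = ∣∣-least
    (+-mono-≤ (≤-trans (x≤∣x∣ x) ∣x∣≤a) (≤-trans (x≤∣x∣ y) ∣y∣≤b))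
    (≤-resp (solve 2 (λ x y → (:- x) :+ (:- y) := :- (x :+ y)) refl x y) refl
      (+-mono-≤ (≤-trans (-x≤∣x∣ x) ∣x∣≤a) (≤-trans (-x≤∣x∣ y) ∣y∣≤b)))

  -- 2 (a b ∓ x y) = (a ∓ x)(b + y) + (a ± x)(b - y)
  ∣∣-* : ∀ {x y a b} → ∣ x ∣ ≤ a → ∣ y ∣ ≤ b → ∣ x * y ∣ ≤ a * b
  ∣∣-* {x} {y} {a} {b} ∣x∣≤a ∣y∣≤b = ∣∣-least
    (*-cancelˡ-≤ (fromℕ-pos 2) (≤-byDifference (+-nonneg (*-nonneg a-x b+y) (*-nonneg a+x b-y))
      (solve 4 (λ x y a b → con (+ 2) :* (x :* y) :+ ((a :- x) :* (b :- (:- y)) :+ (a :- (:- x)) :* (b :- y))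
         := con (+ 2) :* (a :* b)) refl x y a b)))
    (*-cancelˡ-≤ (fromℕ-pos 2) (≤-byDifference (+-nonneg (*-nonneg a+x b+y) (*-nonneg a-x b-y))
      (solve 4 (λ x y a b → con (+ 2) :* (:- (x :* y)) :+ ((a :- (:- x)) :* (b :- (:- y)) :+ (a :- x) :* (b :- y))
         := con (+ 2) :* (a :* b)) refl x y a b)))
    where
    a-x = 0≤difference (≤-trans (x≤∣x∣ x) ∣x∣≤a)
    a+x = 0≤difference (≤-trans (-x≤∣x∣ x) ∣x∣≤a)
    b-y = 0≤difference (≤-trans (x≤∣x∣ y) ∣y∣≤b)
    b+y = 0≤difference (≤-trans (-x≤∣x∣ y) ∣y∣≤b)

  inverse-unique : ∀ {a x y} → a * x ≈ 1# → a * y ≈ 1# → x ≈ y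
  inverse-unique {a} {x} {y} ax≈1 ay≈1 = trans (sym (*-identityʳ x)) (trans (*-congˡ (sym ay≈1))
    (trans (*-leftSwap x a y) (trans (sym (*-assoc a x y)) (trans (*-congʳ ax≈1) (*-identityˡ y)))))

  nonneg∧#0⇒pos : ∀ {x} → 0# ≤ x → x # 0# → 0# < x
  nonneg∧#0⇒pos 0≤x x#0 = [ flip contradiction 0≤x , id ]′ (#⇒<⊎> x#0)

  -- The infimum is not known to be one of its two arguments, so a positive lower bound of both is
  -- needed: half of x if y lies above it, and y itself if y < x.
  ⊓-pos : ∀ {x y} → 0# < x → 0# < y → 0# < x ⊓ y
  ⊓-pos {x} {y} 0<x 0<y = [ (λ x/2<y → <-≤-trans (half*-pos 0<x) (greatest (<⇒≤ x/2<x) (<⇒≤ x/2<y)))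
                          , (λ y<x → <-≤-trans 0<y (greatest (<⇒≤ y<x) ≤-refl)) ]′ (<-cotrans x/2<x y)
    where
    greatest : ∀ {z} → z ≤ x → z ≤ y → z ≤ x ⊓ y
    greatest = proj₂ (proj₂ (⊓-infimum x y)) _
    x/2<x : half * x < x
    x/2<x = <-byDifference (half*-pos 0<x) (halves x)

  -- Multiplied by x y, the two inverses become x and y.
  inv-anti-≤ : ∀ {x y} (x#0 : x # 0#) (y#0 : y # 0#) → 0# < x → x ≤ y → inv y y#0 ≤ inv x x#0
  inv-anti-≤ {x} {y} x#0 y#0 0<x x≤y = *-cancelˡ-≤ 0<x (*-cancelˡ-≤ 0<y (≤-resp
    (trans (sym (*-identityʳ x)) (trans (*-congˡ (sym (inv-inverseʳ y y#0))) (*-leftSwap x y _)))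
    (trans (sym (*-identityʳ y)) (*-congˡ (sym (inv-inverseʳ x x#0)))) x≤y))
    where 0<y = <-≤-trans 0<x x≤y

-- Formal power series, their derivatives, and expansions of rational functions.

module FormalPowerSeries {c ℓ₁ ℓ₂} (ℝ : RealField c ℓ₁ ℓ₂) where
  open RealField ℝ
  open RealFieldProperties ℝ
  open RationalFunctions ℝ
  open OrderedField ℝ
  open SetoidReasoning setoid

  infixl 6 _⊞_
  infixl 8 _⋆_

  _⊞_ : PowerSeries → PowerSeries → PowerSeries
  (f ⊞ g) n = f n + g n

  σ : PowerSeries → PowerSeries
  σ f n = f (suc n)

  -- The Cauchy product, read off from f = f 0 + t (σ f) instead of a sum over i + j = n. Its laws
  -- then follow by induction on n, for all series simultaneously.
  _⋆_ : PowerSeries → PowerSeries → PowerSeries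
  (f ⋆ g) zero    = f 0 * g 0
  (f ⋆ g) (suc n) = f 0 * g (suc n) + (σ f ⋆ g) n

  D : PowerSeries → PowerSeries
  D f n = fromℕ (suc n) * f (suc n)

  ⋆-cong : ∀ {f f′ g g′} → f ≋ f′ → g ≋ g′ → f ⋆ g ≋ f′ ⋆ g′
  ⋆-cong f≋f′ g≋g′ zero    = *-cong (f≋f′ 0) (g≋g′ 0)
  ⋆-cong f≋f′ g≋g′ (suc n) =
    +-cong (*-cong (f≋f′ 0) (g≋g′ (suc n))) (⋆-cong (f≋f′ ∘ suc) g≋g′ n)

  ⋆-congˡ : ∀ {f g g′} → g ≋ g′ → f ⋆ g ≋ f ⋆ g′
  ⋆-congˡ = ⋆-cong (λ _ → refl)

  ⋆-congʳ : ∀ {f f′ g} → f ≋ f′ → f ⋆ g ≋ f′ ⋆ g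
  ⋆-congʳ f≋f′ = ⋆-cong f≋f′ (λ _ → refl)

  ⋆-distribʳ : ∀ h f g → (f ⊞ g) ⋆ h ≋ f ⋆ h ⊞ g ⋆ h
  ⋆-distribʳ h f g zero    = distribʳ _ _ _
  ⋆-distribʳ h f g (suc n) = trans (+-cong (distribʳ _ _ _) (⋆-distribʳ h (σ f) (σ g) n))
    (+-interchange _ _ _ _)

  ∙-⋆ : ∀ a f g → (a ∙ f) ⋆ g ≋ a ∙ f ⋆ g
  ∙-⋆ a f g zero    = *-assoc _ _ _
  ∙-⋆ a f g (suc n) = trans (+-cong (*-assoc _ _ _) (∙-⋆ a (σ f) g n)) (sym (distribˡ a _ _))

  -- The mirror image of the defining recursion, with the constant term split off the right factor;
  -- comparing the two recursions gives commutativity.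
  σ-⋆ʳ : ∀ f g → σ (f ⋆ g) ≋ g 0 ∙ σ f ⊞ f ⋆ σ g
  σ-⋆ʳ f g zero    = trans (+-comm _ _) (+-congʳ (*-comm _ _))
  σ-⋆ʳ f g (suc n) = begin
    f 0 * g (2 ℕ.+ n) + (σ f ⋆ g) (suc n)                   ≈⟨ +-congˡ (σ-⋆ʳ (σ f) g n) ⟩
    f 0 * g (2 ℕ.+ n) + (g 0 * f (2 ℕ.+ n) + (σ f ⋆ σ g) n)
      ≈⟨ solve 3 (λ a b c → a :+ (b :+ c) := b :+ (a :+ c)) refl _ _ _ ⟩
    g 0 * f (2 ℕ.+ n) + (f ⋆ σ g) (suc n)                   ∎

  ⋆-comm : ∀ f g → f ⋆ g ≋ g ⋆ f
  ⋆-comm f g zero    = *-comm _ _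
  ⋆-comm f g (suc n) = trans (σ-⋆ʳ f g n) (+-congˡ (⋆-comm f (σ g) n))

  ⋆-∙ : ∀ a f g → f ⋆ (a ∙ g) ≋ a ∙ f ⋆ g
  ⋆-∙ a f g n = begin
    (f ⋆ (a ∙ g)) n ≈⟨ ⋆-comm f (a ∙ g) n ⟩
    ((a ∙ g) ⋆ f) n ≈⟨ ∙-⋆ a g f n ⟩
    a * (g ⋆ f) n   ≈⟨ *-congˡ (⋆-comm g f n) ⟩
    a * (f ⋆ g) n   ∎

  ⋆-assoc : ∀ f g h → (f ⋆ g) ⋆ h ≋ f ⋆ (g ⋆ h)
  ⋆-assoc f g h zero    = *-assoc _ _ _
  ⋆-assoc f g h (suc n) = begin
    f 0 * g 0 * h (suc n) + (σ (f ⋆ g) ⋆ h) n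
      ≈⟨ +-congˡ (⋆-distribʳ h (f 0 ∙ σ g) (σ f ⋆ g) n) ⟩
    f 0 * g 0 * h (suc n) + (((f 0 ∙ σ g) ⋆ h) n + ((σ f ⋆ g) ⋆ h) n)
      ≈⟨ +-congˡ (+-cong (∙-⋆ (f 0) (σ g) h n) (⋆-assoc (σ f) g h n)) ⟩
    f 0 * g 0 * h (suc n) + (f 0 * (σ g ⋆ h) n + (σ f ⋆ (g ⋆ h)) n)
      ≈⟨ solve 5 (λ a b c d e → a :* b :* c :+ (a :* d :+ e) := a :* (b :* c :+ d) :+ e) refl _ _ _ _ _ ⟩
    f 0 * (g ⋆ h) (suc n) + (σ f ⋆ (g ⋆ h)) n ∎

  ⋆-zeroˡ : ∀ g → (λ _ → 0#) ⋆ g ≋ (λ _ → 0#)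
  ⋆-zeroˡ g zero    = zeroˡ _
  ⋆-zeroˡ g (suc n) = trans (+-cong (zeroˡ _) (⋆-zeroˡ g n)) (+-identityˡ _)

  private
    -- The Euler operator t d/dt. It preserves degrees, so its Leibniz rule is a direct induction
    -- along `_⋆_`; that of `D` follows since `D` is `θ` shifted by one.
    θ : PowerSeries → PowerSeries
    θ f n = fromℕ n * f n

    σθ : ∀ f → σ (θ f) ≋ θ (σ f) ⊞ σ f
    σθ f n = solve 2 (λ k x → (con (+ 1) :+ k) :* x := k :* x :+ x) refl (fromℕ n) (f (suc n))

    θ-⋆ : ∀ f g → θ (f ⋆ g) ≋ θ f ⋆ g ⊞ f ⋆ θ g
    θ-⋆ f g zero    = solve 2 (λ a b → con (+ 0) :* (a :* b) :=
         con (+ 0) :* a :* b :+ a :* (con (+ 0) :* b)) refl (f 0) (g 0)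
    θ-⋆ f g (suc n) = begin
      fromℕ (suc n) * (f 0 * g (suc n) + (σ f ⋆ g) n)
        ≈⟨ solve 4 (λ k a b p → (con (+ 1) :+ k) :* (a :* b :+ p) :=
             a :* ((con (+ 1) :+ k) :* b) :+ p :+ k :* p)
             refl (fromℕ n) (f 0) (g (suc n)) ((σ f ⋆ g) n) ⟩
      f 0 * θ g (suc n) + (σ f ⋆ g) n + θ (σ f ⋆ g) n
        ≈⟨ +-congˡ (θ-⋆ (σ f) g n) ⟩
      f 0 * θ g (suc n) + (σ f ⋆ g) n + ((θ (σ f) ⋆ g) n + (σ f ⋆ θ g) n)
        -- The vanishing summand is inserted because `θ f` has constant term 0# * f 0, which appears
        -- when θ f ⋆ g is unfolded.
        ≈⟨ solve 5 (λ x a p q r → x :+ p :+ (q :+ r) := con (+ 0) :* a :* a :+ (q :+ p) :+ (x :+ r))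
             refl _ (f 0) _ _ _ ⟩
      0# * f 0 * f 0 + ((θ (σ f) ⋆ g) n + (σ f ⋆ g) n) + (f 0 * θ g (suc n) + (σ f ⋆ θ g) n)
        ≈⟨ +-congʳ (+-cong (solve 2 (λ a b → con (+ 0) :* a :* a :=
             con (+ 0) :* a :* b) refl (f 0) (g (suc n)))
             (sym (trans (⋆-congʳ (σθ f) n) (⋆-distribʳ g (θ (σ f)) (σ f) n)))) ⟩
      (θ f ⋆ g ⊞ f ⋆ θ g) (suc n) ∎

  D-⋆ : ∀ f g → D (f ⋆ g) ≋ D f ⋆ g ⊞ f ⋆ D g
  D-⋆ f g n = begin
    θ (f ⋆ g) (suc n)                                ≈⟨ θ-⋆ f g (suc n) ⟩
    (θ f ⋆ g) (suc n) + (f ⋆ θ g) (suc n)           ≈⟨ +-congˡ (σ-⋆ʳ f (θ g) n) ⟩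
    0# * f 0 * g (suc n) + (D f ⋆ g) n + (0# * g 0 * f (suc n) + (f ⋆ D g) n)
      ≈⟨ solve 6 (λ a b x c d y → con (+ 0) :* a :* b :+ x :+ (con (+ 0) :* c :* d :+ y) := x :+ y)
           refl (f 0) (g (suc n)) _ (g 0) (f (suc n)) _ ⟩
    (D f ⋆ g ⊞ f ⋆ D g) n ∎

  D-⊞ : ∀ f g → D (f ⊞ g) ≋ D f ⊞ D g
  D-⊞ f g n = distribˡ _ _ _

  D-∙ : ∀ a f → D (a ∙ f) ≋ a ∙ D f
  D-∙ a f n = *-leftSwap _ _ _

  -- Characteristic zero: this is what allows a coefficient to be recovered from a derivative.
  fromℕ-*-cancelˡ : ∀ n .{{_ : ℕ.NonZero n}} {x y} → fromℕ n * x ≈ fromℕ n * y → x ≈ y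
  fromℕ-*-cancelˡ n {x} {y} nx≈ny = begin
    x                       ≈⟨ *-identityˡ x ⟨
    1# * x                  ≈⟨ *-congʳ (inv-inverseʳ _ (fromℕ#0 n)) ⟨
    fromℕ n * k * x         ≈⟨ solve 3 (λ n k x → n :* k :* x := k :* (n :* x)) refl _ _ _ ⟩
    k * (fromℕ n * x)       ≈⟨ *-congˡ nx≈ny ⟩
    k * (fromℕ n * y)       ≈⟨ solve 3 (λ n k x → n :* k :* x := k :* (n :* x)) refl _ _ _ ⟨
    fromℕ n * k * y         ≈⟨ *-congʳ (inv-inverseʳ _ (fromℕ#0 n)) ⟩
    1# * y                  ≈⟨ *-identityˡ y ⟩
    y                       ∎
    where k = inv (fromℕ n) (fromℕ#0 n)

  -- The first coefficient found by long division is r 0. What it leaves over, shifted down, is σ r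
  -- ⋆ q, so the argument repeats with `σ r`.
  divide-unique : ∀ r {p q} (q#0 : q 0 # 0#) → r ⋆ q ≋ p → divide p q q#0 ≋ r
  divide-unique r {p} {q} q#0 rq≋p n = lemma n
    where
    head : p 0 * inv (q 0) q#0 ≈ r 0
    head = begin
      p 0 * inv (q 0) q#0          ≈⟨ *-congʳ (rq≋p 0) ⟨
      r 0 * q 0 * inv (q 0) q#0    ≈⟨ *-assoc _ _ _ ⟩
      r 0 * (q 0 * inv (q 0) q#0)  ≈⟨ *-congˡ (inv-inverseʳ _ q#0) ⟩
      r 0 * 1#                     ≈⟨ *-identityʳ _ ⟩
      r 0                          ∎
    lemma : divide p q q#0 ≋ r
    lemma zero    = head
    lemma (suc n) = divide-unique (σ r) q#0 (λ i → begin
      (σ r ⋆ q) i ≈⟨ solve 2 (λ a b → b := a :+ b :- a) refl (r 0 * q (suc i)) _ ⟩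
      (r ⋆ q) (suc i) - r 0 * q (suc i) ≈⟨ +-cong (rq≋p (suc i)) (-‿cong (*-congʳ (sym head))) ⟩
      p (suc i) - p 0 * inv (q 0) q#0 * q (suc i) ∎) n

  coeff-⊕ : ∀ p q → coeff (p ⊕ q) ≋ coeff p ⊞ coeff q
  coeff-⊕ []      q       n       = sym (+-identityˡ _)
  coeff-⊕ (a ∷ p) []      n       = sym (+-identityʳ _)
  coeff-⊕ (a ∷ p) (b ∷ q) zero    = refl
  coeff-⊕ (a ∷ p) (b ∷ q) (suc n) = coeff-⊕ p q n

  coeff-⊙ : ∀ a p → coeff (a ⊙ p) ≋ a ∙ coeff p
  coeff-⊙ a []      n       = sym (zeroʳ a)
  coeff-⊙ a (b ∷ p) zero    = refl
  coeff-⊙ a (b ∷ p) (suc n) = coeff-⊙ a p n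

  coeff-⊖ : ∀ p q n → coeff (p ⊖ q) n ≈ coeff p n - coeff q n
  coeff-⊖ p q n = trans (coeff-⊕ p _ n) (+-congˡ (trans (coeff-⊙ _ q n)
    (solve 1 (λ x → (:- con (+ 1)) :* x := :- x) refl _)))

  coeff-⊗ : ∀ p q → coeff (p ⊗ q) ≋ coeff p ⋆ coeff q
  coeff-⊗ []      q n = sym (⋆-zeroˡ (coeff q) n)
  coeff-⊗ (a ∷ p) q zero    = trans (coeff-⊕ (a ⊙ q) (0# ∷ p ⊗ q) 0)
    (trans (+-identityʳ _) (coeff-⊙ a q 0))
  coeff-⊗ (a ∷ p) q (suc n) = trans (coeff-⊕ (a ⊙ q) (0# ∷ p ⊗ q) (suc n))
    (+-cong (coeff-⊙ a q (suc n)) (coeff-⊗ p q n))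

  coeff-derivative : ∀ p → coeff (derivative p) ≋ D (coeff p)
  coeff-derivative []      n       = sym (zeroʳ _)
  coeff-derivative (a ∷ p) zero    = begin
    coeff (p ⊕ (0# ∷ derivative p)) 0 ≈⟨ coeff-⊕ p (0# ∷ derivative p) 0 ⟩
    coeff p 0 + 0#
      ≈⟨ solve 1 (λ x → x :+ con (+ 0) := (con (+ 1) :+ con (+ 0)) :* x) refl _ ⟩
    D (coeff (a ∷ p)) 0               ∎
  coeff-derivative (a ∷ p) (suc n) = begin
    coeff (p ⊕ (0# ∷ derivative p)) (suc n)         ≈⟨ coeff-⊕ p (0# ∷ derivative p) (suc n) ⟩
    coeff p (suc n) + coeff (derivative p) n         ≈⟨ +-congˡ (coeff-derivative p n) ⟩
    coeff p (suc n) + fromℕ (suc n) * coeff p (suc n)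
      ≈⟨ solve 2 (λ k x → x :+ k :* x := (con (+ 1) :+ k) :* x) refl (fromℕ (suc n)) _ ⟩
    D (coeff (a ∷ p)) (suc n)                        ∎

  -- Clearing the denominator gives an equation between products, which can be differentiated
  -- without looking into the long division.
  Represents : PowerSeries → RationalFunction → Set ℓ₁
  Represents r f = r ⋆ coeff (den f) ≋ coeff (num f)

  expansion-unique : ∀ {r} f (reg : RegularAt 0# f) → Represents r f → expansion f reg ≋ r
  expansion-unique f reg = divide-unique _ _

  -- With r q = p: (p′ q - p q′) = (r′ q + r q′) q - r q q′ = r′ q².
  ∂-represents : ∀ {r} f → Represents r f → Represents (D r) (∂ f)
  ∂-represents {r} f@(fraction p q _) rq≋p n = begin
    (D r ⋆ coeff (q ⊗ q)) n                      ≈⟨ ⋆-congˡ (coeff-⊗ q q) n ⟩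
    (D r ⋆ (Q ⋆ Q)) n                            ≈⟨ ⋆-assoc (D r) Q Q n ⟨
    ((D r ⋆ Q) ⋆ Q) n
      ≈⟨ solve 2 (λ x y → x := x :+ y :- y) refl _ (((r ⋆ D Q) ⋆ Q) n) ⟩
    ((D r ⋆ Q) ⋆ Q) n + ((r ⋆ D Q) ⋆ Q) n - ((r ⋆ D Q) ⋆ Q) n
      ≈⟨ +-cong p′q (-‿cong pq′) ⟩
    coeff (derivative p ⊗ q) n - coeff (p ⊗ derivative q) n
      ≈⟨ coeff-⊖ (derivative p ⊗ q) (p ⊗ derivative q) n ⟨
    coeff (num (∂ f)) n ∎
    where
    Q = coeff q
    p′q : ((D r ⋆ Q) ⋆ Q) n + ((r ⋆ D Q) ⋆ Q) n ≈ coeff (derivative p ⊗ q) n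
    p′q = begin
      ((D r ⋆ Q) ⋆ Q) n + ((r ⋆ D Q) ⋆ Q) n  ≈⟨ ⋆-distribʳ Q (D r ⋆ Q) (r ⋆ D Q) n ⟨
      ((D r ⋆ Q ⊞ r ⋆ D Q) ⋆ Q) n
        ≈⟨ ⋆-congʳ (λ i → trans (sym (D-⋆ r Q i)) (*-congˡ (rq≋p (suc i)))) n ⟩
      (D (coeff p) ⋆ Q) n                     ≈⟨ ⋆-congʳ (coeff-derivative p) n ⟨
      (coeff (derivative p) ⋆ Q) n            ≈⟨ coeff-⊗ (derivative p) q n ⟨
      coeff (derivative p ⊗ q) n              ∎
    pq′ : ((r ⋆ D Q) ⋆ Q) n ≈ coeff (p ⊗ derivative q) n
    pq′ = begin
      ((r ⋆ D Q) ⋆ Q) n                       ≈⟨ ⋆-assoc r (D Q) Q n ⟩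
      (r ⋆ (D Q ⋆ Q)) n                       ≈⟨ ⋆-congˡ (⋆-comm (D Q) Q) n ⟩
      (r ⋆ (Q ⋆ D Q)) n                       ≈⟨ ⋆-assoc r Q (D Q) n ⟨
      ((r ⋆ Q) ⋆ D Q) n                       ≈⟨ ⋆-cong rq≋p (λ i → sym (coeff-derivative q i)) n ⟩
      (coeff p ⋆ coeff (derivative q)) n      ≈⟨ coeff-⊗ p (derivative q) n ⟨
      coeff (p ⊗ derivative q) n              ∎

  iterate-D : ℕ → PowerSeries → PowerSeries
  iterate-D zero    f = f
  iterate-D (suc k) f = D (iterate-D k f)

  ∂^-represents : ∀ k {r} f → Represents r f → Represents (iterate-D k r) (∂^ k f)
  ∂^-represents zero    f rep = rep
  ∂^-represents (suc k) f rep = ∂-represents (∂^ k f) (∂^-represents k f rep)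

  open SemiringMult (CommutativeRing.semiring commutativeRing) public
    using () renaming (×1-homo-* to fromℕ-*)

  -- The factor n ! avoids falling factorials: each application of `D` contributes just the n + 1
  -- that turns n ! into (n + 1) !.
  iterate-D-coeff : ∀ k f n → fromℕ (n !) * iterate-D k f n ≈ fromℕ ((k ℕ.+ n) !) * f (k ℕ.+ n)
  iterate-D-coeff zero    f n = refl
  iterate-D-coeff (suc k) f n = begin
    fromℕ (n !) * (fromℕ (suc n) * iterate-D k f (suc n))
      ≈⟨ solve 3 (λ a b x → a :* (b :* x) := b :* a :* x) refl _ _ _ ⟩
    fromℕ (suc n) * fromℕ (n !) * iterate-D k f (suc n)
      ≈⟨ *-congʳ (fromℕ-* (suc n) (n !)) ⟨
    fromℕ (suc n !) * iterate-D k f (suc n)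
      ≈⟨ iterate-D-coeff k f (suc n) ⟩
    fromℕ ((k ℕ.+ suc n) !) * f (k ℕ.+ suc n)
      ≡⟨ ≡.cong (λ i → fromℕ (i !) * f i) (ℕₚ.+-suc k n) ⟩
    fromℕ ((suc k ℕ.+ n) !) * f (suc k ℕ.+ n) ∎

  iterate-D-head : ∀ k f → iterate-D k f 0 ≈ fromℕ (k !) * f k
  iterate-D-head k f = begin
    iterate-D k f 0                    ≈⟨ solve 1 (λ x → x := (con (+ 1) :+ con (+ 0)) :* x) refl _ ⟩
    fromℕ (0 !) * iterate-D k f 0      ≈⟨ iterate-D-coeff k f 0 ⟩
    fromℕ ((k ℕ.+ 0) !) * f (k ℕ.+ 0)  ≡⟨ ≡.cong (λ i → fromℕ (i !) * f i) (ℕₚ.+-identityʳ k) ⟩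
    fromℕ (k !) * f k                  ∎

  valueAt-represents : ∀ {r} f (reg : RegularAt 0# f) → Represents r f → valueAt 0# f reg ≈ r 0
  valueAt-represents {r} f reg rep = begin
    eval (num f) 0# * i              ≈⟨ *-congʳ (coeff₀≈eval (num f)) ⟨
    coeff (num f) 0 * i              ≈⟨ *-congʳ (rep 0) ⟨
    r 0 * coeff (den f) 0 * i        ≈⟨ *-congʳ (*-congˡ (coeff₀≈eval (den f))) ⟩
    r 0 * eval (den f) 0# * i        ≈⟨ *-assoc _ _ _ ⟩
    r 0 * (eval (den f) 0# * i)      ≈⟨ *-congˡ (inv-inverseʳ _ reg) ⟩
    r 0 * 1#                         ≈⟨ *-identityʳ _ ⟩
    r 0                              ∎
    where i = inv (eval (den f) 0#) reg

  -- Taylor's formula at 0 in algebraic form: the k-th derived fraction is represented by the k-th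
  -- derived series, whose constant term is its value.
  valueAt-∂^ : ∀ k {r} f (reg : RegularAt 0# (∂^ k f)) → Represents r f →
               valueAt 0# (∂^ k f) reg ≈ fromℕ (k !) * r k
  valueAt-∂^ k {r} f reg rep =
    trans (valueAt-represents (∂^ k f) reg (∂^-represents k f rep)) (iterate-D-head k r)

  -- The formal sine and cosine series and their addition theorems.

  open SemiringExp (CommutativeRing.semiring commutativeRing) public
    using (^-congˡ; ^-assocʳ)
  open CommutativeSemiringExp (CommutativeRing.commutativeSemiring commutativeRing) public
    using (^-distrib-*)

  expTerm : Carrier → PowerSeries
  expTerm x n = _/ℕ_ (x ^ n) (n !) {{n !≢0}}

  -- The values at 0 of the n-th derivatives of sine and cosine. The mutual recursion is sin′ = cos
  -- and cos′ = - sin, so that these equations hold by computation.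
  sinSign cosSign : ℕ → Carrier
  sinSign zero    = 0#
  sinSign (suc n) = cosSign n
  cosSign zero    = 1#
  cosSign (suc n) = - sinSign n

  -- sin (x t) and cos (x t) in ℝ[[t]].
  sinSeries cosSeries : Carrier → PowerSeries
  sinSeries x n = sinSign n * expTerm x n
  cosSeries x n = cosSign n * expTerm x n

  -- The differential equation E′ = x E of E = exp (x t). After multiplication by n ! each inverse
  -- factorial meets its factorial and cancels.
  expTerm-suc : ∀ x n → fromℕ (suc n) * expTerm x (suc n) ≈ x * expTerm x n
  expTerm-suc x n = fromℕ-*-cancelˡ (n !) (begin
    fromℕ (n !) * (fromℕ (suc n) * (x ^ suc n * i′))
      ≈⟨ solve 5 (λ a b x y i → a :* (b :* (x :* y :* i)) :=
           b :* a :* i :* (x :* y)) refl _ _ x (x ^ n) i′ ⟩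
    fromℕ (suc n) * fromℕ (n !) * i′ * (x * x ^ n)
      ≈⟨ *-congʳ (trans (*-congʳ (sym (fromℕ-* (suc n) (n !)))) (inv-inverseʳ _ (fromℕ#0 (suc n !)))) ⟩
    1# * (x * x ^ n)
      ≈⟨ *-congʳ (inv-inverseʳ _ (fromℕ#0 (n !))) ⟨
    fromℕ (n !) * i * (x * x ^ n)
      ≈⟨ solve 4 (λ a x y i → a :* i :* (x :* y) := a :* (x :* (y :* i))) refl _ x (x ^ n) i ⟩
    fromℕ (n !) * (x * (x ^ n * i)) ∎)
    where
    instance
      n!≢0 = n !≢0
      n+1!≢0 = suc n !≢0
    i  = inv (fromℕ (n !)) (fromℕ#0 (n !))
    i′ = inv (fromℕ (suc n !)) (fromℕ#0 (suc n !))

  expTerm-0 : ∀ x → expTerm x 0 ≈ 1#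
  expTerm-0 x = trans (*-congʳ (sym (+-identityʳ 1#))) (inv-inverseʳ _ (fromℕ#0 1))

  D-sin : ∀ x → D (sinSeries x) ≋ x ∙ cosSeries x
  D-sin x n = trans (*-leftSwap _ _ _) (trans (*-congˡ (expTerm-suc x n)) (*-leftSwap _ _ _))

  D-cos : ∀ x → D (cosSeries x) ≋ - x ∙ sinSeries x
  D-cos x n = trans (*-leftSwap _ _ _) (trans (*-congˡ (expTerm-suc x n))
    (solve 3 (λ s x e → (:- s) :* (x :* e) := (:- x) :* (s :* e)) refl (sinSign n) x (expTerm x n)))

  sin-add cos-add : Carrier → Carrier → PowerSeries
  sin-add x y = sinSeries x ⋆ cosSeries y ⊞ cosSeries x ⋆ sinSeries y
  cos-add x y = cosSeries x ⋆ cosSeries y ⊞ - 1# ∙ sinSeries x ⋆ sinSeries y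

  private
    D-⋆′ : ∀ {f g a b f′ g′} → D f ≋ a ∙ f′ → D g ≋ b ∙ g′ →
           D (f ⋆ g) ≋ a ∙ f′ ⋆ g ⊞ b ∙ f ⋆ g′
    D-⋆′ {f} {g} {a} {b} {f′} {g′} Df Dg n = trans (D-⋆ f g n)
      (+-cong (trans (⋆-congʳ Df n) (∙-⋆ a f′ g n)) (trans (⋆-congˡ Dg n) (⋆-∙ b f g′ n)))

  D-sin-add : ∀ x y → D (sin-add x y) ≋ (x + y) ∙ cos-add x y
  D-sin-add x y n = begin
    D (sin-add x y) n
      ≈⟨ D-⊞ (sinSeries x ⋆ cosSeries y) (cosSeries x ⋆ sinSeries y) n ⟩
    D (sinSeries x ⋆ cosSeries y) n + D (cosSeries x ⋆ sinSeries y) n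
      ≈⟨ +-cong (D-⋆′ (D-sin x) (D-cos y) n) (D-⋆′ (D-cos x) (D-sin y) n) ⟩
    x * (cosSeries x ⋆ cosSeries y) n + - y * (sinSeries x ⋆ sinSeries y) n
      + (- x * (sinSeries x ⋆ sinSeries y) n + y * (cosSeries x ⋆ cosSeries y) n)
      ≈⟨ solve 4 (λ x y c s → x :* c :+ (:- y) :* s :+ ((:- x) :* s :+ y :* c) :=
           (x :+ y) :* (c :+ (:- con (+ 1)) :* s))
           refl x y _ _ ⟩
    (x + y) * cos-add x y n ∎

  D-cos-add : ∀ x y → D (cos-add x y) ≋ - (x + y) ∙ sin-add x y
  D-cos-add x y n = begin
    D (cos-add x y) n
      ≈⟨ D-⊞ (cosSeries x ⋆ cosSeries y) (- 1# ∙ sinSeries x ⋆ sinSeries y) n ⟩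
    D (cosSeries x ⋆ cosSeries y) n + D (- 1# ∙ sinSeries x ⋆ sinSeries y) n
      ≈⟨ +-cong (D-⋆′ (D-cos x) (D-cos y) n)
           (trans (D-∙ (- 1#) (sinSeries x ⋆ sinSeries y) n) (*-congˡ (D-⋆′ (D-sin x) (D-sin y) n))) ⟩
    - x * (sinSeries x ⋆ cosSeries y) n + - y * (cosSeries x ⋆ sinSeries y) n
      + - 1# * (x * (cosSeries x ⋆ sinSeries y) n + y * (sinSeries x ⋆ cosSeries y) n)
      ≈⟨ solve 4 (λ x y a b → (:- x) :* a :+ (:- y) :* b :+ (:- con (+ 1)) :* (x :* b :+ y :* a) :=
           (:- (x :+ y)) :* (a :+ b))
           refl x y _ _ ⟩
    - (x + y) * sin-add x y n ∎

  private
    sin-0 : ∀ x → sinSeries x 0 ≈ 0#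
    sin-0 x = zeroˡ _

    cos-0 : ∀ x → cosSeries x 0 ≈ 1#
    cos-0 x = trans (*-identityˡ _) (expTerm-0 x)

  -- Both pairs solve f′ = z g, g′ = - z f with f(0) = 0, g(0) = 1.
  sin-cos-addition : ∀ {x y z} → x + y ≈ z → ∀ n →
    sin-add x y n ≈ sinSeries z n × cos-add x y n ≈ cosSeries z n
  sin-cos-addition {x} {y} {z} x+y≈z zero =
    trans (+-cong (trans (*-congʳ (sin-0 x)) (zeroˡ _)) (trans (*-congˡ (sin-0 y)) (zeroʳ _)))
      (trans (+-identityˡ _) (sym (sin-0 z))) ,
    trans (+-cong (trans (*-cong (cos-0 x) (cos-0 y)) (*-identityˡ _))
      (trans (*-congˡ (trans (*-congʳ (sin-0 x)) (zeroˡ _))) (zeroʳ _)))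
      (trans (+-identityʳ _) (sym (cos-0 z)))
  sin-cos-addition {x} {y} {z} x+y≈z (suc n) with sin-cos-addition x+y≈z n
  ... | s≈ , c≈ =
    fromℕ-*-cancelˡ (suc n) (trans (D-sin-add x y n) (trans (*-cong x+y≈z c≈) (sym (D-sin z n)))) ,
    fromℕ-*-cancelˡ (suc n) (trans (D-cos-add x y n) (trans (*-cong (-‿cong x+y≈z) s≈) (sym (D-cos z n))))

  sin²+cos² : Carrier → PowerSeries
  sin²+cos² x = sinSeries x ⋆ sinSeries x ⊞ cosSeries x ⋆ cosSeries x

  sin²+cos²-0 : ∀ x → sin²+cos² x 0 ≈ 1#
  sin²+cos²-0 x = trans (+-cong (trans (*-congʳ (sin-0 x)) (zeroˡ _))
    (trans (*-cong (cos-0 x) (cos-0 x)) (*-identityˡ _))) (+-identityˡ _)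

  -- By the product rule the derivative of sin² + cos² is a sum of terms that cancel in pairs.
  sin²+cos²-suc : ∀ x n → sin²+cos² x (suc n) ≈ 0#
  sin²+cos²-suc x n = fromℕ-*-cancelˡ (suc n) (begin
    D (sin²+cos² x) n
      ≈⟨ D-⊞ (sinSeries x ⋆ sinSeries x) (cosSeries x ⋆ cosSeries x) n ⟩
    D (sinSeries x ⋆ sinSeries x) n + D (cosSeries x ⋆ cosSeries x) n
      ≈⟨ +-cong (D-⋆′ (D-sin x) (D-sin x) n) (D-⋆′ (D-cos x) (D-cos x) n) ⟩
    x * (cosSeries x ⋆ sinSeries x) n + x * (sinSeries x ⋆ cosSeries x) n
      + (- x * (sinSeries x ⋆ cosSeries x) n + - x * (cosSeries x ⋆ sinSeries x) n)
      ≈⟨ solve 4 (λ x a b k → x :* a :+ x :* b :+ ((:- x) :* b :+ (:- x) :* a) :=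
           k :* con (+ 0)) refl x _ _ (fromℕ (suc n)) ⟩
    fromℕ (suc n) * 0# ∎)

-- Limits, geometrically dominated series and products of series.

module Limits {c ℓ₁ ℓ₂} (ℝ : RealField c ℓ₁ ℓ₂) where
  open RealField ℝ
  open RealFieldProperties ℝ
  open RationalFunctions ℝ using (PowerSeries; _≋_)
  open OrderedField ℝ
  open FormalPowerSeries ℝ

  ∣x-y∣-swap : ∀ {x y b} → ∣ x - y ∣ ≤ b → ∣ y - x ∣ ≤ b
  ∣x-y∣-swap {x} {y} ∣x-y∣≤b = ≤-trans
    (≤-resp (∣∣-cong (solve 2 (λ x y → :- (x :- y) := y :- x) refl x y)) refl (∣-∣ (x - y))) ∣x-y∣≤b

  ∣0∣≈0 : ∣ 0# ∣ ≈ 0#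
  ∣0∣≈0 = ∣∣-of-nonneg ≤-refl

  archimedean-* : ∀ {d} → 0# < d → ∀ x → ∃[ N ] x < fromℕ N * d
  archimedean-* {d} 0<d x with archimedean (inv d (pos⇒#0 0<d) * x)
  ... | N , x/d<N = N , <-resp
    (trans (sym (*-assoc _ _ _)) (trans (*-congʳ (inv-inverseʳ d _)) (*-identityˡ x)))
    (*-comm _ _) (*-monoˡ-< 0<d x/d<N)

  -- If M < L, then at a large common index both errors are below half the gap L - M, while a n ≤ b
  -- n bounds the gap by their sum, so it would be smaller than itself. The offset `N₀` admits
  -- sequences that compare only eventually, such as the partial sums of sin² + cos².
  limit-≤ : ∀ {a b L M} N₀ → (∀ n → N₀ ℕ.≤ n → a n ≤ b n) → ConvergesTo a L → ConvergesTo b M → L ≤ M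
  limit-≤ {a} {b} {L} {M} N₀ a≤b a→L b→M M<L = absurd
    where
    open ≤-Reasoning
    ε = half * (L - M)
    0<ε = half*-pos (0<difference M<L)
    Nₐ = proj₁ (a→L ε 0<ε)
    N_b = proj₁ (b→M ε 0<ε)
    n = N₀ ℕ.⊔ (Nₐ ℕ.⊔ N_b)
    a-close : ∣ a n - L ∣ < ε
    a-close = proj₂ (a→L ε 0<ε) n (ℕₚ.≤-trans (ℕₚ.m≤m⊔n Nₐ N_b) (ℕₚ.m≤n⊔m N₀ _))
    b-close : ∣ b n - M ∣ < ε
    b-close = proj₂ (b→M ε 0<ε) n (ℕₚ.≤-trans (ℕₚ.m≤n⊔m Nₐ N_b) (ℕₚ.m≤n⊔m N₀ _))
    absurd = ≤-refl (begin-strict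
      L - M
        ≈⟨ solve 4 (λ l m a b → l :- m := (:- (a :- l) :+ (b :- m)) :+ (a :- b)) refl L M (a n) (b n) ⟩
      - (a n - L) + (b n - M) + (a n - b n)
        ≤⟨ +-mono-≤ (+-mono-≤ (-x≤∣x∣ _) (x≤∣x∣ _)) (≤-byDifference (0≤difference (a≤b n (ℕₚ.m≤m⊔n N₀ _)))
                                                 (solve 2 (λ a b → a :- b :+ (b :- a) :=
                                                      con (+ 0)) refl (a n) (b n))) ⟩
      ∣ a n - L ∣ + ∣ b n - M ∣ + 0#        ≈⟨ +-identityʳ _ ⟩
      ∣ a n - L ∣ + ∣ b n - M ∣             <⟨ +-mono-< a-close b-close ⟩
      ε + ε                                 ≈⟨ halves (L - M) ⟩
      L - M                                 ∎)

  limit-unique : ∀ {a b L M} N₀ → (∀ n → N₀ ℕ.≤ n → a n ≈ b n) → ConvergesTo a L → ConvergesTo b M → L ≈ M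
  limit-unique N₀ a≈b a→L b→M = ≤-antisym
    (limit-≤ N₀ (λ n N≤n → ≤-reflexive (a≈b n N≤n)) a→L b→M)
    (limit-≤ N₀ (λ n N≤n → ≤-reflexive (sym (a≈b n N≤n))) b→M a→L)

  limit-const : ∀ L → ConvergesTo (λ _ → L) L
  limit-const L ε 0<ε = 0 , λ _ _ → <-resp (sym (trans (∣∣-cong (-‿inverseʳ L)) ∣0∣≈0)) refl 0<ε

  limit-+ : ∀ {a b L M} → ConvergesTo a L → ConvergesTo b M → ConvergesTo (λ n → a n + b n) (L + M)
  limit-+ {a} {b} {L} {M} a→L b→M ε 0<ε = N ℕ.⊔ N′ , λ n N≤n → begin-strict
    ∣ a n + b n - (L + M) ∣
      ≈⟨ ∣∣-cong (solve 4 (λ a b l m → a :+ b :- (l :+ m) := a :- l :+ (b :- m)) refl (a n) (b n) L M) ⟩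
    ∣ a n - L + (b n - M) ∣      ≤⟨ ∣∣-+ ≤-refl ≤-refl ⟩
    ∣ a n - L ∣ + ∣ b n - M ∣
      <⟨ +-mono-< (proj₂ a-close n (ℕₚ.m⊔n≤o⇒m≤o N N′ N≤n)) (proj₂ b-close n (ℕₚ.m⊔n≤o⇒n≤o N N′ N≤n)) ⟩
    half * ε + half * ε          ≈⟨ halves ε ⟩
    ε                            ∎
    where
    open ≤-Reasoning
    a-close = a→L (half * ε) (half*-pos 0<ε)
    b-close = b→M (half * ε) (half*-pos 0<ε)
    N = proj₁ a-close
    N′ = proj₁ b-close

  limit-scaled : ∀ {a L} → ConvergesTo a L → ∀ {K} → 0# < K → ∀ ε → 0# < ε →
                 ∃[ N ] (∀ n → N ℕ.≤ n → K * ∣ a n - L ∣ < ε)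
  limit-scaled {a} {L} a→L {K} 0<K ε 0<ε with a→L (inv K K#0 * ε) (*-pos (inv-pos K K#0 0<K) 0<ε)
    where K#0 = pos⇒#0 0<K
  ... | N , close = N , λ n N≤n → <-resp refl
    (trans (sym (*-assoc _ _ _)) (trans (*-congʳ (inv-inverseʳ K _)) (*-identityˡ ε)))
    (*-monoˡ-< 0<K (close n N≤n))

  limit-* : ∀ {a b L M} → ConvergesTo a L → ConvergesTo b M → ConvergesTo (λ n → a n * b n) (L * M)
  limit-* {a} {b} {L} {M} a→L b→M ε 0<ε = N ℕ.⊔ (Nₐ ℕ.⊔ N_b) , λ n ≤n →
    let n₁ = ℕₚ.m⊔n≤o⇒m≤o N _ ≤n
        n₂ = ℕₚ.m⊔n≤o⇒m≤o Nₐ N_b (ℕₚ.m⊔n≤o⇒n≤o N _ ≤n)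
        n₃ = ℕₚ.m⊔n≤o⇒n≤o Nₐ N_b (ℕₚ.m⊔n≤o⇒n≤o N _ ≤n)
    in begin-strict
    ∣ a n * b n - L * M ∣
      -- Once ∣ a n - L ∣ < 1, the factor of b n - M is at most 1 + ∣ L ∣. The other factor is
      -- enlarged from ∣ M ∣ to 1 + ∣ M ∣ because `limit-scaled` divides by it.
      ≈⟨ ∣∣-cong (solve 4 (λ a b l m → a :* b :- l :* m :=
           ((a :- l) :+ l) :* (b :- m) :+ m :* (a :- l)) refl _ _ L M) ⟩
    ∣ ((a n - L) + L) * (b n - M) + M * (a n - L) ∣
      ≤⟨ ∣∣-+ (∣∣-* (∣∣-+ (<⇒≤ (proj₂ (a→L 1# 0<1) n n₁)) ≤-refl) ≤-refl)
              (∣∣-* (≤-byDifference 0≤1 (+-comm _ _)) ≤-refl) ⟩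
    (1# + ∣ L ∣) * ∣ b n - M ∣ + (1# + ∣ M ∣) * ∣ a n - L ∣
      <⟨ +-mono-< (proj₂ b-close n n₃) (proj₂ a-close n n₂) ⟩
    half * ε + half * ε  ≈⟨ halves ε ⟩
    ε                    ∎
    where
    open ≤-Reasoning
    0<1+∣_∣ : ∀ x → 0# < 1# + ∣ x ∣
    0<1+∣ x ∣ = <-≤-trans 0<1 (≤-byDifference (∣∣-nonneg x) refl)
    N = proj₁ (a→L 1# 0<1)
    a-close = limit-scaled a→L 0<1+∣ M ∣ (half * ε) (half*-pos 0<ε)
    b-close = limit-scaled b→M 0<1+∣ L ∣ (half * ε) (half*-pos 0<ε)
    Nₐ = proj₁ a-close
    N_b = proj₁ b-close

  -- From ρ ^ n (1 + n (1 - ρ)) ≤ 1.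
  powers-vanish : ∀ {ρ B} → 0# < ρ → ρ < 1# → 0# ≤ B → ∀ ε → 0# < ε →
                  ∃[ N ] (∀ n → N ℕ.≤ n → B * ρ ^ n < ε)
  powers-vanish {ρ} {B} 0<ρ ρ<1 0≤B ε 0<ε = proj₁ N-large , λ n N≤n →
    *-cancelˡ-< (0<1+nh n) (begin-strict
      (1# + fromℕ n * h) * (B * ρ ^ n)
        ≈⟨ solve 3 (λ a b r → a :* (b :* r) := b :* (r :* a)) refl _ B _ ⟩
      B * (ρ ^ n * (1# + fromℕ n * h))      ≤⟨ *-monoˡ-≤ 0≤B (bernoulli n) ⟩
      B * 1#                                ≈⟨ *-identityʳ B ⟩
      B                                     <⟨ proj₂ N-large ⟩
      fromℕ (proj₁ N-large) * (h * ε)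
        ≤⟨ *-mono-≤ (fromℕ-nonneg (proj₁ N-large)) (<⇒≤ (*-pos 0<h 0<ε)) (fromℕ-mono-≤ N≤n) ≤-refl ⟩
      fromℕ n * (h * ε)                     ≤⟨ ≤-byDifference (<⇒≤ 0<ε)
                                                 (solve 3 (λ n h e → n :* (h :* e) :+ e :=
                                                      (con (+ 1) :+ n :* h) :* e) refl (fromℕ n) h ε) ⟩
      (1# + fromℕ n * h) * ε                ∎)
    where
    open ≤-Reasoning
    h = 1# - ρ
    0<h : 0# < h
    0<h = 0<difference ρ<1
    N-large = archimedean-* (*-pos 0<h 0<ε) B
    0≤nh : ∀ n → 0# ≤ fromℕ n * h
    0≤nh n = *-nonneg (fromℕ-nonneg n) (<⇒≤ 0<h)
    0<1+nh : ∀ n → 0# < 1# + fromℕ n * h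
    0<1+nh n = <-≤-trans 0<1 (≤-byDifference (0≤nh n) refl)
    bernoulli : ∀ n → ρ ^ n * (1# + fromℕ n * h) ≤ 1#
    bernoulli zero    = ≤-reflexive (solve 1 (λ h → con (+ 1) :* (con (+ 1) :+ con (+ 0) :* h) :=
         con (+ 1)) refl h)
    -- Passing from n to n + 1 lowers the left side by exactly ρ ^ n (n + 1) h².
    bernoulli (suc n) = ≤-trans (≤-byDifference
      (*-nonneg (^-nonneg n (<⇒≤ 0<ρ)) (*-nonneg (fromℕ-nonneg (suc n)) (0≤square h)))
      (solve 3 (λ r p n → let h = con (+ 1) :- r in
          r :* p :* (con (+ 1) :+ (con (+ 1) :+ n) :* h) :+ p :* ((con (+ 1) :+ n) :* (h :* h))
            := p :* (con (+ 1) :+ n :* h))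
        refl ρ (ρ ^ n) (fromℕ n))) (bernoulli n)

  Sum : PowerSeries → Carrier → Set _
  Sum f L = ConvergesTo (partialSum f) L

  partialSum-cong : ∀ {f g} → f ≋ g → partialSum f ≋ partialSum g
  partialSum-cong f≋g zero    = refl
  partialSum-cong f≋g (suc n) = +-cong (partialSum-cong f≋g n) (f≋g n)

  Sum-unique : ∀ {f g L M} → f ≋ g → Sum f L → Sum g M → L ≈ M
  Sum-unique f≋g = limit-unique 0 (λ n _ → partialSum-cong f≋g n)

  partialSum-⊞ : ∀ f g → partialSum (f ⊞ g) ≋ partialSum f ⊞ partialSum g
  partialSum-⊞ f g zero    = sym (+-identityˡ _)
  partialSum-⊞ f g (suc n) = trans (+-congʳ (partialSum-⊞ f g n))
    (solve 4 (λ a b c d → a :+ b :+ (c :+ d) := a :+ c :+ (b :+ d)) refl _ _ _ _)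

  limit-cong : ∀ {a b L M} → (∀ n → a n ≈ b n) → L ≈ M → ConvergesTo a L → ConvergesTo b M
  limit-cong a≈b L≈M a→L ε 0<ε = proj₁ (a→L ε 0<ε) , λ n N≤n →
    <-resp (∣∣-cong (+-cong (a≈b n) (-‿cong L≈M))) refl (proj₂ (a→L ε 0<ε) n N≤n)

  geometricLimit : ∀ {ρ B a L} → 0# < ρ → ρ < 1# → 0# ≤ B → (∀ n → ∣ a n - L ∣ ≤ B * ρ ^ n) → ConvergesTo a L
  geometricLimit 0<ρ ρ<1 0≤B error ε 0<ε = proj₁ small , λ n N≤n → ≤-<-trans (error n) (proj₂ small n N≤n)
    where small = powers-vanish 0<ρ ρ<1 0≤B ε 0<ε

  Sum-⊞ : ∀ {f g L M} → Sum f L → Sum g M → Sum (f ⊞ g) (L + M)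
  Sum-⊞ {f} {g} Σf Σg = limit-cong (λ n → sym (partialSum-⊞ f g n)) refl (limit-+ Σf Σg)

  -- The comparison test with an explicit remainder. `bound` is determined by A and ρ and does not
  -- depend on f, which later makes convergence uniform.
  module GeometricallyBounded {ρ A : Carrier} {f : PowerSeries} (0<ρ : 0# < ρ) (ρ<1 : ρ < 1#) (0≤A : 0# ≤ A)
                              (∣f∣≤ : ∀ n → ∣ f n ∣ ≤ A * ρ ^ n) where
    open ≤-Reasoning

    private
      1-ρ#0 : 1# - ρ # 0#
      1-ρ#0 = pos⇒#0 (0<difference ρ<1)

      P : PowerSeries
      P = partialSum f

    bound : Carrier
    bound = A * inv (1# - ρ) 1-ρ#0

    bound-nonneg : 0# ≤ bound
    bound-nonneg = *-nonneg 0≤A (<⇒≤ (inv-pos _ 1-ρ#0 (0<difference ρ<1)))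

    private
      boundρⁿ-nonneg : ∀ n → 0# ≤ bound * ρ ^ n
      boundρⁿ-nonneg n = *-nonneg bound-nonneg (^-nonneg n (<⇒≤ 0<ρ))

      A≈ : A ≈ bound * (1# - ρ)
      A≈ = sym (trans (*-assoc _ _ _)
        (trans (*-congˡ (trans (*-comm _ _) (inv-inverseʳ _ 1-ρ#0))) (*-identityʳ A)))

      -- The exact value of the geometric sum stands on the right, so that the induction telescopes
      -- through A = bound (1 - ρ).
      tail : ∀ n k → ∣ P (k ℕ.+ n) - P n ∣ ≤ bound * ρ ^ n - bound * ρ ^ (k ℕ.+ n)
      tail n zero    = ≤-reflexive (trans (trans (∣∣-cong (-‿inverseʳ _)) ∣0∣≈0) (sym (-‿inverseʳ _)))
      tail n (suc k) = begin
        ∣ P k+n + f k+n - P n ∣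
          ≈⟨ ∣∣-cong (solve 3 (λ a b c → a :+ b :- c := a :- c :+ b) refl _ _ _) ⟩
        ∣ P k+n - P n + f k+n ∣                           ≤⟨ ∣∣-+ (tail n k) (∣f∣≤ k+n) ⟩
        bound * ρ ^ n - bound * ρ ^ k+n + A * ρ ^ k+n     ≈⟨ +-congˡ (*-congʳ A≈) ⟩
        bound * ρ ^ n - bound * ρ ^ k+n + bound * (1# - ρ) * ρ ^ k+n
          ≈⟨ solve 4 (λ b p q r → b :* p :- b :* q :+ b :* (con (+ 1) :- r) :* q :=
               b :* p :- b :* (r :* q)) refl bound _ _ ρ ⟩
        bound * ρ ^ n - bound * (ρ * ρ ^ k+n)             ∎
        where k+n = k ℕ.+ n

    tail-bound : ∀ {n m} → n ℕ.≤ m → ∣ P m - P n ∣ ≤ bound * ρ ^ n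
    tail-bound {n} {m} n≤m = ≤-trans
      (≤-resp (∣∣-cong (+-congʳ (reflexive (≡.cong P (ℕₚ.m∸n+n≡m n≤m))))) refl (tail n (m ℕ.∸ n)))
      (≤-byDifference (boundρⁿ-nonneg (m ℕ.∸ n ℕ.+ n)) (solve 2 (λ a b → a :- b :+ b := a) refl _ _))

    private
      cauchy : Cauchy P
      cauchy ε 0<ε = N , λ i j N≤i N≤j → begin-strict
        ∣ P i - P j ∣
          ≈⟨ ∣∣-cong (solve 3 (λ a b c → a :- b := a :- c :+ (c :- b)) refl (P i) (P j) (P N)) ⟩
        ∣ P i - P N + (P N - P j) ∣   ≤⟨ ∣∣-+ (tail-bound N≤i) (∣x-y∣-swap (tail-bound N≤j)) ⟩
        bound * ρ ^ N + bound * ρ ^ N <⟨ +-mono-< small small ⟩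
        half * ε + half * ε           ≈⟨ halves ε ⟩
        ε                             ∎
        where
        N-small = powers-vanish 0<ρ ρ<1 bound-nonneg (half * ε) (half*-pos 0<ε)
        N = proj₁ N-small
        small : bound * ρ ^ N < half * ε
        small = proj₂ N-small N ℕₚ.≤-refl

    abstract
      total : Carrier
      total = proj₁ (complete P cauchy)

      sums : Sum f total
      sums = proj₂ (complete P cauchy)

    -- Were the error larger, its excess over the bound could serve as the ε of convergence. A later
    -- partial sum within that ε of the total then contradicts `tail-bound`.
    error-bound : ∀ n → ∣ P n - total ∣ ≤ bound * ρ ^ n
    error-bound n far = ≤-refl (begin-strict
      ∣ P n - total ∣
        ≈⟨ ∣∣-cong (solve 3 (λ a b c → a :- b := a :- c :+ (c :- b)) refl (P n) total (P m)) ⟩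
      ∣ P n - P m + (P m - total) ∣          ≤⟨ ∣∣-+ (∣x-y∣-swap (tail-bound (ℕₚ.m≤n⊔m N n))) ≤-refl ⟩
      bound * ρ ^ n + ∣ P m - total ∣        <⟨ +-monoʳ-< _ (proj₂ N-close m (ℕₚ.m≤m⊔n N n)) ⟩
      bound * ρ ^ n + (∣ P n - total ∣ - bound * ρ ^ n)
        ≈⟨ solve 2 (λ b p → b :+ (p :- b) := p) refl (bound * ρ ^ n) ∣ P n - total ∣ ⟩
      ∣ P n - total ∣                        ∎)
      where
      N-close = sums _ (0<difference far)
      N = proj₁ N-close
      m = N ℕ.⊔ n

  quarter : Carrier
  quarter = half * half

  half<1 : half < 1#
  half<1 = <-byDifference half-pos half+half≈1

  quarter-pos : 0# < quarter
  quarter-pos = *-pos half-pos half-pos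

  quarter<half : quarter < half
  quarter<half = <-byDifference quarter-pos (halves half)

  quarter<1 : quarter < 1#
  quarter<1 = <-trans quarter<half half<1

  partialSum-σ : ∀ f n → partialSum f (suc n) ≈ f 0 + partialSum (σ f) n
  partialSum-σ f zero    = +-comm _ _
  partialSum-σ f (suc n) = trans (+-congʳ (partialSum-σ f n)) (+-assoc _ _ _)

  partialSum-⋆ : ∀ f g n → partialSum (f ⋆ g) (suc n) ≈ f 0 * partialSum g (suc n) + partialSum (σ f ⋆ g) n
  partialSum-⋆ f g zero    = solve 2 (λ a b → con (+ 0) :+ a :* b :=
       a :* (con (+ 0) :+ b) :+ con (+ 0)) refl (f 0) (g 0)
  partialSum-⋆ f g (suc n) = trans (+-congʳ (partialSum-⋆ f g n))
    (solve 5 (λ a p q b r → a :* p :+ q :+ (a :* b :+ r) := a :* (p :+ b) :+ (q :+ r)) refl (f 0) _ _ _ _)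

  private
    σ-bound : ∀ {A ρ f} → (∀ n → ∣ f n ∣ ≤ A * ρ ^ n) → ∀ n → ∣ σ f n ∣ ≤ A * ρ * ρ ^ n
    σ-bound ∣f∣≤ n = ≤-resp refl (sym (*-assoc _ _ _)) (∣f∣≤ (suc n))

    quarter+quarter : ∀ x → x * quarter + x * quarter ≈ half * x
    quarter+quarter x = trans (sym (distribˡ x _ _)) (trans (*-congˡ (halves half)) (*-comm x half))

  -- The geometric sum is 4 A / 3; the rounder A + A reproduces itself under the shift, since A + 2
  -- (A / 4) ≤ A + A.
  partialSum-bound : ∀ {A f} → 0# ≤ A → (∀ n → ∣ f n ∣ ≤ A * quarter ^ n) → ∀ n → ∣ partialSum f n ∣ ≤ A + A
  partialSum-bound {A} {f} 0≤A ∣f∣≤ zero    = ≤-resp (sym ∣0∣≈0) refl (+-nonneg 0≤A 0≤A)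
  partialSum-bound {A} {f} 0≤A ∣f∣≤ (suc n) = begin
    ∣ partialSum f (suc n) ∣           ≈⟨ ∣∣-cong (partialSum-σ f n) ⟩
    ∣ f 0 + partialSum (σ f) n ∣
      ≤⟨ ∣∣-+ (∣f∣≤ 0) (partialSum-bound (*-nonneg 0≤A (<⇒≤ quarter-pos)) (σ-bound ∣f∣≤) n) ⟩
    A * 1# + (A * quarter + A * quarter) ≈⟨ +-cong (*-identityʳ A) (quarter+quarter A) ⟩
    A + half * A
      ≤⟨ ≤-byDifference (*-nonneg (<⇒≤ half-pos) 0≤A) (trans (+-assoc _ _ _) (+-congˡ (halves A))) ⟩
    A + A                              ∎
    where open ≤-Reasoning

  -- Splitting off f 0 leaves the error for `σ f`, whose constant is A / 4, and the product of g n
  -- with a partial sum of `σ f`, which is at most A / 2. Each contributes (A / 2) B / 2^n, and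
  -- their sum A B / 2^n is exactly 2 A B / 2^(n+1).
  product-error : ∀ {A B f g} → 0# ≤ A → (∀ n → ∣ f n ∣ ≤ A * quarter ^ n) →
    0# ≤ B → (∀ n → ∣ g n ∣ ≤ B * half ^ n) →
    ∀ n → ∣ partialSum (f ⋆ g) n - partialSum f n * partialSum g n ∣ ≤ (A + A) * B * half ^ n
  product-error {A} {B} {f} {g} 0≤A ∣f∣≤ 0≤B ∣g∣≤ zero    = ≤-resp
    (trans (sym ∣0∣≈0) (∣∣-cong (solve 0 (con (+ 0) := con (+ 0) :- con (+ 0) :* con (+ 0)) refl)))
    (sym (*-identityʳ _)) (*-nonneg (+-nonneg 0≤A 0≤A) 0≤B)
  product-error {A} {B} {f} {g} 0≤A ∣f∣≤ 0≤B ∣g∣≤ (suc n) = begin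
    ∣ partialSum (f ⋆ g) (suc n) - partialSum f (suc n) * partialSum g (suc n) ∣
      ≈⟨ ∣∣-cong (+-cong (partialSum-⋆ f g n) (-‿cong (*-congʳ (partialSum-σ f n)))) ⟩
    ∣ f 0 * (G + g n) + partialSum (σ f ⋆ g) n - (f 0 + F) * (G + g n) ∣
      ≈⟨ ∣∣-cong (solve 5 (λ a b c d e → a :* (b :+ c) :+ d :- (a :+ e) :* (b :+ c) :=
           (d :- e :* b) :+ :- (e :* c)) refl (f 0) _ _ _ _) ⟩
    ∣ (partialSum (σ f ⋆ g) n - F * G) + - (F * g n) ∣
      ≤⟨ ∣∣-+ (product-error 0≤A/4 (σ-bound ∣f∣≤) 0≤B ∣g∣≤ n)
              (≤-trans (∣-∣ _) (∣∣-* (partialSum-bound 0≤A/4 (σ-bound ∣f∣≤) n) (∣g∣≤ n))) ⟩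
    (A * quarter + A * quarter) * B * half ^ n + (A * quarter + A * quarter) * (B * half ^ n)
      ≈⟨ +-cong (*-congʳ (*-congʳ (quarter+quarter A))) (*-congʳ (quarter+quarter A)) ⟩
    half * A * B * half ^ n + half * A * (B * half ^ n)
      ≈⟨ solve 4 (λ h a b p → h :* a :* b :* p :+ h :* a :* (b :* p) :=
           (a :+ a) :* b :* (h :* p)) refl half A B _ ⟩
    (A + A) * B * half ^ suc n ∎
    where
    open ≤-Reasoning
    F = partialSum (σ f) n
    G = partialSum g n
    0≤A/4 = *-nonneg 0≤A (<⇒≤ quarter-pos)

  Sum-⋆ : ∀ {A B f g L M} → 0# ≤ A → (∀ n → ∣ f n ∣ ≤ A * quarter ^ n) →
          0# ≤ B → (∀ n → ∣ g n ∣ ≤ B * half ^ n) →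
          Sum f L → Sum g M → Sum (f ⋆ g) (L * M)
  Sum-⋆ {A} {B} {f} {g} {L} {M} 0≤A ∣f∣≤ 0≤B ∣g∣≤ Σf Σg = limit-cong
    (λ n → solve 2 (λ a b → a :- b :+ b := a) refl (partialSum (f ⋆ g) n) (partialSum f n * partialSum g n))
    (+-identityˡ (L * M))
    (limit-+ (geometricLimit half-pos half<1 (*-nonneg (+-nonneg 0≤A 0≤A) 0≤B) error) (limit-* Σf Σg))
    where
    error : ∀ n → ∣ partialSum (f ⋆ g) n - partialSum f n * partialSum g n - 0# ∣ ≤ (A + A) * B * half ^ n
    error n = ≤-resp (∣∣-cong (sym (x-0≈x _))) refl (product-error 0≤A ∣f∣≤ 0≤B ∣g∣≤ n)

  eventuallyDecreasing⇒bounded : ∀ N (b : ℕ → Carrier) → (∀ n → N ℕ.≤ n → b (suc n) ≤ b n) →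
                                 ∃[ A ] (0# ≤ A × ∀ n → b n ≤ A)
  eventuallyDecreasing⇒bounded zero    b dec = ∣ b 0 ∣ , ∣∣-nonneg _ , below
    where
    below : ∀ n → b n ≤ ∣ b 0 ∣
    below zero    = x≤∣x∣ _
    below (suc n) = ≤-trans (dec n ℕ.z≤n) (below n)
  eventuallyDecreasing⇒bounded (suc N) b dec
    with eventuallyDecreasing⇒bounded N (b ∘ suc) (λ n N≤n → dec (suc n) (ℕ.s≤s N≤n))
  ... | A , 0≤A , b≤A = ∣ b 0 ∣ + A , +-nonneg (∣∣-nonneg _) 0≤A , below
    where
    below : ∀ n → b n ≤ ∣ b 0 ∣ + A
    below zero    = ≤-trans (x≤∣x∣ _) (≤-byDifference 0≤A refl)
    below (suc n) = ≤-trans (b≤A n) (≤-byDifference (∣∣-nonneg _) (+-comm _ _))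

-- Convergence of the trigonometric series and the reflection formula.

module TrigonometricSeries {c ℓ₁ ℓ₂} (ℝ : RealField c ℓ₁ ℓ₂) where
  open RealField ℝ
  open RealFieldProperties ℝ
  open RationalFunctions ℝ using (PowerSeries; _≋_; *-leftSwap)
  open OrderedField ℝ
  open FormalPowerSeries ℝ
  open Limits ℝ

  4^n*quarter^n : ∀ n → fromℕ 4 ^ n * quarter ^ n ≈ 1#
  4^n*quarter^n n = trans (sym (^-distrib-* (fromℕ 4) quarter n)) (trans (^-congˡ n 4*quarter≈1) (1^ n))
    where
    1^ : ∀ n → 1# ^ n ≈ 1#
    1^ zero    = refl
    1^ (suc n) = trans (*-identityˡ _) (1^ n)
    4*quarter≈1 : fromℕ 4 * quarter ≈ 1#
    4*quarter≈1 = trans (solve 1 (λ h → con (+ 4) :* (h :* h) := (h :+ h) :* (h :+ h)) refl half)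
      (trans (*-cong half+half≈1 half+half≈1) (*-identityˡ 1#))

  -- 4^n ∣ x ∣^n / n ! no longer grows once n + 1 exceeds 4 ∣ x ∣, and the Archimedean axiom
  -- supplies such an index. The rate `quarter` is the one that `product-error` asks of its left
  -- factor.
  expTerm-bound : ∀ x → ∃[ A ] (0# ≤ A × ∀ n → ∣ expTerm x n ∣ ≤ A * quarter ^ n)
  expTerm-bound x = A , proj₁ (proj₂ bounded) , λ n → ≤-resp
    (trans (solve 3 (λ a b c → a :* (b :* c) :=
         b :* a :* c) refl (quarter ^ n) (fromℕ 4 ^ n) ∣ expTerm x n ∣)
      (trans (*-congʳ (4^n*quarter^n n)) (*-identityˡ _)))
    (*-comm (quarter ^ n) A)
    (*-monoˡ-≤ (^-nonneg n (<⇒≤ quarter-pos)) (proj₂ (proj₂ bounded) n))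
    where
    open ≤-Reasoning
    N = proj₁ (archimedean (fromℕ 4 * ∣ x ∣))
    4∣x∣<N = proj₂ (archimedean (fromℕ 4 * ∣ x ∣))
    decreasing : ∀ n → N ℕ.≤ n → fromℕ 4 ^ suc n * ∣ expTerm x (suc n) ∣ ≤ fromℕ 4 ^ n * ∣ expTerm x n ∣
    decreasing n N≤n = *-cancelˡ-≤ (fromℕ-pos (suc n)) (begin
      fromℕ (suc n) * (fromℕ 4 ^ suc n * ∣ expTerm x (suc n) ∣)
        ≈⟨ *-leftSwap _ _ _ ⟩
      fromℕ 4 ^ suc n * (fromℕ (suc n) * ∣ expTerm x (suc n) ∣)
        ≤⟨ *-monoˡ-≤ (^-nonneg (suc n) (fromℕ-nonneg 4)) step ⟩
      fromℕ 4 ^ suc n * (∣ x ∣ * ∣ expTerm x n ∣)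
        ≈⟨ solve 4 (λ f p x e → f :* p :* (x :* e) :=
             f :* x :* (p :* e)) refl (fromℕ 4) (fromℕ 4 ^ n) ∣ x ∣ ∣ expTerm x n ∣ ⟩
      fromℕ 4 * ∣ x ∣ * (fromℕ 4 ^ n * ∣ expTerm x n ∣)
        ≤⟨ *-mono-≤ (*-nonneg (fromℕ-nonneg 4) (∣∣-nonneg x)) 0≤term
             (≤-trans (<⇒≤ 4∣x∣<N) (fromℕ-mono-≤ (ℕₚ.≤-trans N≤n (ℕₚ.n≤1+n n)))) ≤-refl ⟩
      fromℕ (suc n) * (fromℕ 4 ^ n * ∣ expTerm x n ∣) ∎)
      where
      0≤term : 0# ≤ fromℕ 4 ^ n * ∣ expTerm x n ∣
      0≤term = *-nonneg (^-nonneg n (fromℕ-nonneg 4)) (∣∣-nonneg _)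
      k = inv (fromℕ (suc n)) (fromℕ#0 (suc n))
      0≤k : 0# ≤ k
      0≤k = <⇒≤ (inv-pos _ (fromℕ#0 (suc n)) (fromℕ-pos (suc n)))
      nk≈1 : fromℕ (suc n) * k ≈ 1#
      nk≈1 = inv-inverseʳ _ (fromℕ#0 (suc n))
      step : fromℕ (suc n) * ∣ expTerm x (suc n) ∣ ≤ ∣ x ∣ * ∣ expTerm x n ∣
      step = begin
        fromℕ (suc n) * ∣ expTerm x (suc n) ∣
          ≈⟨ *-congˡ (∣∣-cong (fromℕ-*-cancelˡ (suc n) (trans (expTerm-suc x n) (trans (sym (*-identityˡ _))
               (trans (*-congʳ (sym nk≈1)) (*-assoc _ _ _)))))) ⟩
        fromℕ (suc n) * ∣ k * (x * expTerm x n) ∣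
          ≤⟨ *-monoˡ-≤ (fromℕ-nonneg (suc n)) (∣∣-* (≤-reflexive (∣∣-of-nonneg 0≤k)) (∣∣-* ≤-refl ≤-refl)) ⟩
        fromℕ (suc n) * (k * (∣ x ∣ * ∣ expTerm x n ∣))
          ≈⟨ trans (sym (*-assoc _ _ _)) (trans (*-congʳ nk≈1) (*-identityˡ _)) ⟩
        ∣ x ∣ * ∣ expTerm x n ∣ ∎
    bounded = eventuallyDecreasing⇒bounded N (λ n → fromℕ 4 ^ n * ∣ expTerm x n ∣) decreasing
    A = proj₁ bounded

  sign-bound : ∀ n → ∣ sinSign n ∣ ≤ 1# × ∣ cosSign n ∣ ≤ 1#
  sign-bound zero    = ≤-resp (sym ∣0∣≈0) refl 0≤1 , ≤-reflexive (∣∣-of-nonneg 0≤1)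
  sign-bound (suc n) = proj₂ (sign-bound n) , ≤-trans (∣-∣ _) (proj₁ (sign-bound n))

  private
    signed-bound : ∀ {s x b} → ∣ s ∣ ≤ 1# → ∣ x ∣ ≤ b → ∣ s * x ∣ ≤ b
    signed-bound ∣s∣≤1 ∣x∣≤b = ≤-resp refl (*-identityˡ _) (∣∣-* ∣s∣≤1 ∣x∣≤b)

    quarter⇒half : ∀ {A} {f : PowerSeries} → 0# ≤ A →
                   (∀ n → ∣ f n ∣ ≤ A * quarter ^ n) → ∀ n → ∣ f n ∣ ≤ A * half ^ n
    quarter⇒half 0≤A ∣f∣≤ n = ≤-trans (∣f∣≤ n)
      (*-monoˡ-≤ 0≤A (^-monoˡ-≤ n (<⇒≤ quarter-pos) (<⇒≤ quarter<half)))

  module _ (x : Carrier) where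
    private
      A   = proj₁ (expTerm-bound x)
      0≤A = proj₁ (proj₂ (expTerm-bound x))

    sinSeries-bound : ∀ n → ∣ sinSeries x n ∣ ≤ A * quarter ^ n
    sinSeries-bound n = signed-bound (proj₁ (sign-bound n)) (proj₂ (proj₂ (expTerm-bound x)) n)

    cosSeries-bound : ∀ n → ∣ cosSeries x n ∣ ≤ A * quarter ^ n
    cosSeries-bound n = signed-bound (proj₂ (sign-bound n)) (proj₂ (proj₂ (expTerm-bound x)) n)

    private
      module SinSeries = GeometricallyBounded quarter-pos quarter<1 0≤A sinSeries-bound
      module CosSeries = GeometricallyBounded quarter-pos quarter<1 0≤A cosSeries-bound

    -- `Trigonometry` provides the sine alone; the cosine is produced by completeness as the sum of
    -- its series.
    cos : Carrier
    cos = CosSeries.total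

    Sum-cos : Sum (cosSeries x) cos
    Sum-cos = CosSeries.sums

    private
      -- Each recursion step exposes two successors, matching two terms of `sinSeries`; `2 ℕ.* n`
      -- does not unfold in this way.
      double : ℕ → ℕ
      double zero    = 0
      double (suc n) = suc (suc (double n))

      n≤double : ∀ n → n ℕ.≤ double n
      n≤double zero    = ℕ.z≤n
      n≤double (suc n) = ℕ.s≤s (ℕₚ.m≤n⇒m≤1+n (n≤double n))

      double≡2* : ∀ n → suc (double n) ≡ 2 ℕ.* n ℕ.+ 1
      double≡2* zero    = ≡.refl
      double≡2* (suc n) = ≡.trans (≡.cong (suc ∘ suc) (double≡2* n))
        (≡.cong (λ k → suc (k ℕ.+ 1)) (≡.sym (ℕₚ.+-suc n (n ℕ.+ 0))))

      signs-double : ∀ n → sinSign (double n) ≈ 0# × cosSign (double n) ≈ (- 1#) ^ n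
      signs-double zero    = refl , refl
      signs-double (suc n) =
        trans (-‿cong (proj₁ (signs-double n))) (solve 0 (:- con (+ 0) := con (+ 0)) refl) ,
        trans (-‿cong (proj₂ (signs-double n))) (solve 1 (λ y → :- y := (:- con (+ 1)) :* y) refl _)

      sinSeries-odd : ∀ n → sinSeries x (suc (double n)) ≈ sinTerm x n
      sinSeries-odd n = *-cong (proj₂ (signs-double n)) (reflexive (≡.cong (expTerm x) (double≡2* n)))

      partialSum-double : ∀ n → partialSum (sinSeries x) (double n) ≈ partialSum (sinTerm x) n
      partialSum-double zero    = refl
      partialSum-double (suc n) = +-cong
        (trans (+-cong (partialSum-double n) (trans (*-congʳ (proj₁ (signs-double n))) (zeroˡ _)))
          (+-identityʳ _))
        (sinSeries-odd n)

    -- `sinTerm` lists odd powers only, so its partial sums are those of `sinSeries` at even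
    -- indices. The full series converges by its geometric bound, and the limit along this
    -- subsequence identifies its total as s.
    Sum-sin : ∀ {s} → ConvergesTo (partialSum (sinTerm x)) s → Sum (sinSeries x) s
    Sum-sin {s} sin-converges = limit-cong (λ _ → refl) total≈s SinSeries.sums
      where
      subsequence : ConvergesTo (partialSum (sinSeries x) ∘ double) SinSeries.total
      subsequence ε 0<ε = proj₁ (SinSeries.sums ε 0<ε) , λ n N≤n →
        proj₂ (SinSeries.sums ε 0<ε) (double n) (ℕₚ.≤-trans N≤n (n≤double n))
      total≈s : SinSeries.total ≈ s
      total≈s = limit-unique 0 (λ n _ → partialSum-double n) subsequence sin-converges

  module _ (T : Trigonometry ℝ) where
    open Trigonometry T
    private
      sinΣ : ∀ x → Sum (sinSeries x) (sin x)
      sinΣ x = Sum-sin x (sin-series x)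

      bound-of : ∀ x → 0# ≤ proj₁ (expTerm-bound x)
      bound-of x = proj₁ (proj₂ (expTerm-bound x))

      module Product {f g : Carrier → PowerSeries}
        (f≤ : ∀ x n → ∣ f x n ∣ ≤ proj₁ (expTerm-bound x) * quarter ^ n)
        (g≤ : ∀ x n → ∣ g x n ∣ ≤ proj₁ (expTerm-bound x) * quarter ^ n) where
        product : ∀ x y {L M} → Sum (f x) L → Sum (g y) M → Sum (f x ⋆ g y) (L * M)
        product x y = Sum-⋆ (bound-of x) (f≤ x) (bound-of y) (quarter⇒half {f = g y} (bound-of y) (g≤ y))
      open Product

    -- `Trigonometry` has no congruence law for `sin`, so z may be any element equal to x + y; the
    -- identity between coefficients absorbs the equation.
    sin-+ : ∀ {x y z} → x + y ≈ z → sin z ≈ sin x * cos y + cos x * sin y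
    sin-+ {x} {y} {z} x+y≈z = Sum-unique (λ n → sym (proj₁ (sin-cos-addition x+y≈z n))) (sinΣ z)
      (Sum-⊞ (product sinSeries-bound cosSeries-bound x y (sinΣ x) (Sum-cos y))
             (product cosSeries-bound sinSeries-bound x y (Sum-cos x) (sinΣ y)))

    sin*sin+cos*cos : ∀ x → sin x * sin x + cos x * cos x ≈ 1#
    sin*sin+cos*cos x = limit-unique 1 (λ n 1≤n → constant n 1≤n)
      (Sum-⊞ (product sinSeries-bound sinSeries-bound x x (sinΣ x) (sinΣ x))
             (product cosSeries-bound cosSeries-bound x x (Sum-cos x) (Sum-cos x)))
      (limit-const 1#)
      where
      constant : ∀ n → 1 ℕ.≤ n → partialSum (sin²+cos² x) n ≈ 1#
      constant (suc zero)    _ = trans (+-identityˡ _) (sin²+cos²-0 x)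
      constant (suc (suc n)) _ =
        trans (+-cong (constant (suc n) (ℕ.s≤s ℕ.z≤n)) (sin²+cos²-suc x n)) (+-identityʳ 1#)

    -- Only sin π = 0 is used: it gives sin x cos y = - cos x sin y, and squaring
    -- eliminates the cosines.
    sin-reflection : ∀ {x y} → x + y ≈ π → sin x * sin x ≈ sin y * sin y
    sin-reflection {x} {y} x+y≈π = begin
      s * s
        ≈⟨ solve 2 (λ s t → s :* s := s :* s :* t :+ s :* s :* (con (+ 1) :- t)) refl s (t * t) ⟩
      s * s * (t * t) + s * s * (1# - t * t)
        ≈⟨ +-congˡ (*-congˡ (+-congʳ (sin*sin+cos*cos y))) ⟨
      s * s * (t * t) + s * s * (t * t + d * d - t * t)
        ≈⟨ solve 3 (λ s t d → s :* s :* (t :* t) :+ s :* s :* (t :* t :+ d :* d :- t :* t) :=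
             s :* s :* (t :* t) :+ s :* d :* (s :* d)) refl s t d ⟩
      s * s * (t * t) + s * d * (s * d)
        ≈⟨ solve 4 (λ s t c d → s :* s :* (t :* t) :+ s :* d :* (s :* d) :=
             (s :* s :+ c :* c) :* (t :* t) :+ (s :* d :+ c :* t) :* (s :* d :- c :* t)) refl s t k d ⟩
      (s * s + k * k) * (t * t) + (s * d + k * t) * (s * d - k * t)
        ≈⟨ +-cong (*-congʳ (sin*sin+cos*cos x)) (*-congʳ (trans (sym (sin-+ x+y≈π)) sin-π)) ⟩
      1# * (t * t) + 0# * (s * d - k * t)
        ≈⟨ solve 2 (λ t z → con (+ 1) :* t :+ con (+ 0) :* z := t) refl _ _ ⟩
      t * t ∎
      where
      open SetoidReasoning setoid
      s = sin x
      t = sin y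
      k = cos x
      d = cos y

-- Finite sums over selected lists.

module FiniteSums {c ℓ₁ ℓ₂} (ℝ : RealField c ℓ₁ ℓ₂) where
  open RealField ℝ
  open RealFieldProperties ℝ
  open OrderedField ℝ

  sumOver-cong : ∀ {a} {A : Set a} (xs : List A) {f g : A → Carrier} →
                 (∀ x → f x ≈ g x) → sumOver xs f ≈ sumOver xs g
  sumOver-cong []       f≈g = refl
  sumOver-cong (x ∷ xs) f≈g = +-cong (f≈g x) (sumOver-cong xs f≈g)

  sumOver-zero : ∀ {a} {A : Set a} (xs : List A) {f : A → Carrier} → (∀ x → f x ≈ 0#) → sumOver xs f ≈ 0#
  sumOver-zero []       f≈0 = refl
  sumOver-zero (x ∷ xs) f≈0 = trans (+-cong (f≈0 x) (sumOver-zero xs f≈0)) (+-identityˡ 0#)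

  *-sumOver : ∀ {a} {A : Set a} k (xs : List A) (f : A → Carrier) →
              k * sumOver xs f ≈ sumOver xs (λ x → k * f x)
  *-sumOver k []       f = zeroʳ k
  *-sumOver k (x ∷ xs) f = trans (distribˡ k _ _) (+-congˡ (*-sumOver k xs f))

  sumOver-++ : ∀ {a} {A : Set a} (xs ys : List A) (f : A → Carrier) →
               sumOver (xs ++ ys) f ≈ sumOver xs f + sumOver ys f
  sumOver-++ []       ys f = sym (+-identityˡ _)
  sumOver-++ (x ∷ xs) ys f = trans (+-congˡ (sumOver-++ xs ys f)) (sym (+-assoc _ _ _))

  sumOver-map : ∀ {a b} {A : Set a} {B : Set b} (g : A → B) (xs : List A) (f : B → Carrier) →
                sumOver (map g xs) f ≈ sumOver xs (f ∘ g)
  sumOver-map g []       f = refl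
  sumOver-map g (x ∷ xs) f = +-congˡ (sumOver-map g xs f)

  sumOver-cartesianProduct : ∀ {a b} {A : Set a} {B : Set b} (xs : List A) (ys : List B) (f : A × B → Carrier) →
    sumOver (cartesianProduct xs ys) f ≈ sumOver xs λ x → sumOver ys λ y → f (x , y)
  sumOver-cartesianProduct []       ys f = refl
  sumOver-cartesianProduct (x ∷ xs) ys f = trans (sumOver-++ (map (x ,_) ys) _ f)
    (+-cong (sumOver-map (x ,_) ys f) (sumOver-cartesianProduct xs ys f))

  -- Entries of a selected list carry membership proofs, which blocks splitting the sum into
  -- iterated ones. Extension by zero moves the summation to the full list.
  extendByZero : ∀ {p} {P : Set p} → Dec P → (P → Carrier) → Carrier
  extendByZero (yes p) f = f p
  extendByZero (no _)  f = 0#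

  -- The proof stored in the decision need not be the one at hand, so the value of f has to be known
  -- at every proof.
  extendByZero-yes : ∀ {p} {P : Set p} (d : Dec P) {f : P → Carrier} {x} →
                     P → (∀ p → f p ≈ x) → extendByZero d f ≈ x
  extendByZero-yes (yes p) _ f≈x = f≈x p
  extendByZero-yes (no ¬p) p f≈x = contradiction p ¬p

  extendByZero-no : ∀ {p} {P : Set p} (d : Dec P) {f : P → Carrier} → ¬ P → extendByZero d f ≈ 0#
  extendByZero-no (yes p) ¬p = contradiction p ¬p
  extendByZero-no (no _)  ¬p = refl

  extendByZero-* : ∀ {p} {P : Set p} (d : Dec P) k (f : P → Carrier) →
    extendByZero d (λ p → k * f p) ≈ k * extendByZero d f
  extendByZero-* (yes p) k f = refl
  extendByZero-* (no _)  k f = sym (zeroʳ k)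

  sumOver-select : ∀ {a p} {A : Set a} {P : Pred A p} (P? : Decidable P) (xs : List A) (f : Σ A P → Carrier) →
    sumOver (select P? xs) f ≈ sumOver xs λ x → extendByZero (P? x) λ p → f (x , p)
  sumOver-select P? []       f = refl
  sumOver-select P? (x ∷ xs) f with P? x
  ... | yes p = +-congˡ (sumOver-select P? xs f)
  ... | no  _ = trans (sumOver-select P? xs f) (sym (+-identityˡ _))

  sumOver-tabulate-single : ∀ {a} {A : Set a} {n} (g : Fin n → A) (f : A → Carrier) k →
    (∀ i → i ≢ k → f (g i) ≈ 0#) → sumOver (tabulate g) f ≈ f (g k)
  sumOver-tabulate-single {n = suc n} g f Fin.zero    f≈0 =
    trans (+-congˡ (sumOver-tabulate-zero (g ∘ Fin.suc) (λ i → f≈0 (Fin.suc i) λ ()))) (+-identityʳ _)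
    where
    sumOver-tabulate-zero : ∀ {n} (g : Fin n → _) → (∀ i → f (g i) ≈ 0#) → sumOver (tabulate g) f ≈ 0#
    sumOver-tabulate-zero {zero}  g f≈0 = refl
    sumOver-tabulate-zero {suc n} g f≈0 =
      trans (+-cong (f≈0 Fin.zero) (sumOver-tabulate-zero (g ∘ Fin.suc) (f≈0 ∘ Fin.suc))) (+-identityˡ 0#)
  sumOver-tabulate-single {n = suc n} g f (Fin.suc k) f≈0 =
    trans (+-cong (f≈0 Fin.zero λ ())
      (sumOver-tabulate-single (g ∘ Fin.suc) f k (λ i i≢k → f≈0 (Fin.suc i) (i≢k ∘ Finₚ.suc-injective))))
      (+-identityˡ _)

  sumOver-nonneg : ∀ {a} {A : Set a} (xs : List A) {f : A → Carrier} → (∀ x → 0# ≤ f x) → 0# ≤ sumOver xs f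
  sumOver-nonneg []       0≤f = ≤-refl
  sumOver-nonneg (x ∷ xs) 0≤f = +-nonneg (0≤f x) (sumOver-nonneg xs 0≤f)

-- Logarithmic derivative of a product of linear factors, and bounds for power sums.

module SpectralZeta {c ℓ₁ ℓ₂} (ℝ : RealField c ℓ₁ ℓ₂) {a} {A : Set a}
                    (ev : A → RealField.Carrier ℝ)
                    (ev#0 : ∀ j → RealField._#_ ℝ (ev j) (RealField.0# ℝ)) where
  open RealField ℝ
  open RealFieldProperties ℝ
  open RationalFunctions ℝ
  open OrderedField ℝ
  open FormalPowerSeries ℝ
  open FiniteSums ℝ
  open SetoidReasoning setoid

  invPower : ℕ → A → Carrier
  invPower n j = inv (ev j) (ev#0 j) ^ n

  factor : A → Poly
  factor j = ev j ∷ - 1# ∷ []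

  private
    ⋆-constant : ∀ a f → f ⋆ coeff (a ∷ []) ≋ a ∙ f
    ⋆-constant a f zero    = *-comm _ _
    ⋆-constant a f (suc n) = trans (+-cong (zeroʳ _) (⋆-constant a (σ f) n)) (+-identityˡ _)

    -- The coefficients of 1 / (ev j - w).
    geometric : A → PowerSeries
    geometric j n = invPower (suc n) j

    geometric-⋆-factor : ∀ j → geometric j ⋆ coeff (factor j) ≋ coeff 1ₚ
    geometric-⋆-factor j zero    =
      trans (*-congʳ (*-identityʳ _)) (trans (*-comm _ _) (inv-inverseʳ _ (ev#0 j)))
    geometric-⋆-factor j (suc n) = begin
      (geometric j ⋆ coeff (factor j)) (suc n)
        ≈⟨ σ-⋆ʳ (geometric j) (coeff (factor j)) n ⟩
      ev j * (i * geometric j n) + (geometric j ⋆ coeff (- 1# ∷ [])) n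
        ≈⟨ +-cong (trans (sym (*-assoc _ _ _)) (*-congʳ (inv-inverseʳ _ (ev#0 j))))
             (⋆-constant (- 1#) (geometric j) n) ⟩
      1# * geometric j n + - 1# * geometric j n
        ≈⟨ solve 1 (λ g → con (+ 1) :* g :+ (:- con (+ 1)) :* g := con (+ 0)) refl (geometric j n) ⟩
      0# ∎
      where i = inv (ev j) (ev#0 j)

    D-factor : ∀ j → D (coeff (factor j)) ≋ - 1# ∙ coeff 1ₚ
    D-factor j zero          = solve 0 ((con (+ 1) :+ con (+ 0)) :* (:- con (+ 1)) :=
         (:- con (+ 1)) :* con (+ 1)) refl
    D-factor j (suc n)       = trans (zeroʳ _) (sym (zeroʳ _))

    1ₚ-⋆ : ∀ f → coeff 1ₚ ⋆ f ≋ f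
    1ₚ-⋆ f n = trans (⋆-comm (coeff 1ₚ) f n) (trans (⋆-constant 1# f n) (*-identityˡ _))

  -- For a new factor L with L′ = - 1, the product rule gives - (L P)′ = P - L P′. The series 1 / L
  -- times L P yields the first term, and the induction hypothesis multiplied by L yields the
  -- second. Stated without quotients, this is what `Represents` asks for.
  logDerivative : ∀ xs → (λ n → sumOver xs (invPower (suc n))) ⋆ coeff (productOver xs factor)
                         ≋ - 1# ∙ D (coeff (productOver xs factor))
  logDerivative []       n = trans (⋆-zeroˡ (coeff 1ₚ) n) (sym (trans (*-congˡ (zeroʳ _)) (zeroʳ _)))
  logDerivative (j ∷ xs) n = begin
    ((geometric j ⊞ S) ⋆ coeff (factor j ⊗ P)) n
      ≈⟨ ⋆-congˡ (coeff-⊗ (factor j) P) n ⟩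
    ((geometric j ⊞ S) ⋆ (L ⋆ coeff P)) n
      ≈⟨ ⋆-distribʳ (L ⋆ coeff P) (geometric j) S n ⟩
    (geometric j ⋆ (L ⋆ coeff P)) n + (S ⋆ (L ⋆ coeff P)) n
      ≈⟨ +-cong geometric-part remaining-part ⟩
    coeff P n + - 1# * (L ⋆ D (coeff P)) n
      ≈⟨ solve 2 (λ p q → p :+ (:- con (+ 1)) :* q :=
           (:- con (+ 1)) :* ((:- con (+ 1)) :* p :+ q)) refl (coeff P n) _ ⟩
    - 1# * (- 1# * coeff P n + (L ⋆ D (coeff P)) n)
      ≈⟨ *-congˡ (+-congʳ factor′) ⟨
    - 1# * ((D L ⋆ coeff P) n + (L ⋆ D (coeff P)) n)
      ≈⟨ *-congˡ (sym (D-⋆ L (coeff P) n)) ⟩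
    - 1# * D (L ⋆ coeff P) n
      ≈⟨ *-congˡ (*-congˡ (coeff-⊗ (factor j) P (suc n))) ⟨
    - 1# * D (coeff (factor j ⊗ P)) n ∎
    where
    P = productOver xs factor
    L = coeff (factor j)
    S : PowerSeries
    S n = sumOver xs (invPower (suc n))
    factor′ : (D L ⋆ coeff P) n ≈ - 1# * coeff P n
    factor′ = begin
      (D L ⋆ coeff P) n                 ≈⟨ ⋆-congʳ (D-factor j) n ⟩
      ((- 1# ∙ coeff 1ₚ) ⋆ coeff P) n   ≈⟨ ∙-⋆ (- 1#) (coeff 1ₚ) (coeff P) n ⟩
      - 1# * (coeff 1ₚ ⋆ coeff P) n     ≈⟨ *-congˡ (1ₚ-⋆ (coeff P) n) ⟩
      - 1# * coeff P n                  ∎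
    geometric-part : (geometric j ⋆ (L ⋆ coeff P)) n ≈ coeff P n
    geometric-part = begin
      (geometric j ⋆ (L ⋆ coeff P)) n   ≈⟨ ⋆-assoc (geometric j) L (coeff P) n ⟨
      ((geometric j ⋆ L) ⋆ coeff P) n   ≈⟨ ⋆-congʳ (geometric-⋆-factor j) n ⟩
      (coeff 1ₚ ⋆ coeff P) n            ≈⟨ 1ₚ-⋆ (coeff P) n ⟩
      coeff P n                         ∎
    remaining-part : (S ⋆ (L ⋆ coeff P)) n ≈ - 1# * (L ⋆ D (coeff P)) n
    remaining-part = begin
      (S ⋆ (L ⋆ coeff P)) n             ≈⟨ ⋆-assoc S L (coeff P) n ⟨
      ((S ⋆ L) ⋆ coeff P) n             ≈⟨ ⋆-congʳ (⋆-comm S L) n ⟩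
      ((L ⋆ S) ⋆ coeff P) n             ≈⟨ ⋆-assoc L S (coeff P) n ⟩
      (L ⋆ (S ⋆ coeff P)) n             ≈⟨ ⋆-congˡ (logDerivative xs) n ⟩
      (L ⋆ (- 1# ∙ D (coeff P))) n      ≈⟨ ⋆-∙ (- 1#) L (D (coeff P)) n ⟩
      - 1# * (L ⋆ D (coeff P)) n        ∎

  module _ (0≤ev : ∀ j → 0# ≤ ev j) where
    0<ev : ∀ j → 0# < ev j
    0<ev j = nonneg∧#0⇒pos (0≤ev j) (ev#0 j)

    0≤invPower : ∀ n j → 0# ≤ invPower n j
    0≤invPower n j = ^-nonneg n (<⇒≤ (inv-pos _ (ev#0 j) (0<ev j)))

    foldr-⊓-pos : ∀ {μ} → 0# < μ → ∀ xs → 0# < foldr (λ j ν → ev j ⊓ ν) μ xs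
    foldr-⊓-pos 0<μ []       = 0<μ
    foldr-⊓-pos 0<μ (j ∷ xs) = ⊓-pos (0<ev j) (foldr-⊓-pos 0<μ xs)

    -- The fold changes as the list shrinks, so its lower bound ν is kept as a separate parameter; ν
    -- lies below each entry because the infimum does.
    sumOver-invPower-bound : ∀ {μ ν} (ν#0 : ν # 0#) → 0# < ν → ∀ n xs → ν ≤ foldr (λ j κ → ev j ⊓ κ) μ xs →
      sumOver xs (invPower n) ≤ fromℕ (length xs) * inv ν ν#0 ^ n
    sumOver-invPower-bound ν#0 0<ν n []       ν≤ = ≤-reflexive (sym (zeroˡ _))
    sumOver-invPower-bound ν#0 0<ν n (j ∷ xs) ν≤ = ≤-trans
      (+-mono-≤ (^-monoˡ-≤ n (<⇒≤ (inv-pos _ (ev#0 j) (0<ev j)))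
                  (inv-anti-≤ ν#0 (ev#0 j) 0<ν (≤-trans ν≤ (proj₁ (⊓-infimum _ _)))))
                (sumOver-invPower-bound ν#0 0<ν n xs (≤-trans ν≤ (proj₁ (proj₂ (⊓-infimum _ _))))))
      (≤-reflexive (solve 2 (λ k p → p :+ k :* p := (con (+ 1) :+ k) :* p) refl (fromℕ (length xs)) _))

-- The complex modulus and uniform convergence of power series on a disc.

module ComplexSeries {c ℓ₁ ℓ₂} (ℝ : RealField c ℓ₁ ℓ₂) where
  open RealField ℝ
  open RealFieldProperties ℝ
  open OrderedField ℝ
  open FormalPowerSeries ℝ using (^-congˡ; ^-distrib-*)
  open Limits ℝ
  open Complex ℝ

  -- Being polynomial in the components, the squared modulus is multiplicative by ring algebra;
  -- estimates are made on it and transferred to `∣_∣ℂ` by `square-cancel-≤`.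
  normSq : ℂ → Carrier
  normSq z = re z * re z + im z * im z

  normSq-nonneg : ∀ z → 0# ≤ normSq z
  normSq-nonneg z = +-nonneg (0≤square (re z)) (0≤square (im z))

  normSq-* : ∀ z w → normSq (z *ℂ w) ≈ normSq z * normSq w
  normSq-* (a +i b) (a′ +i b′) = solve 4 (λ a b c d →
    (a :* c :- b :* d) :* (a :* c :- b :* d) :+ (a :* d :+ b :* c) :* (a :* d :+ b :* c)
      := (a :* a :+ b :* b) :* (c :* c :+ d :* d)) refl a b a′ b′

  normSq-^ : ∀ z n → normSq (z ^ℂ n) ≈ normSq z ^ n
  normSq-^ z zero    = solve 0 (con (+ 1) :* con (+ 1) :+ con (+ 0) :* con (+ 0) := con (+ 1)) refl
  normSq-^ z (suc n) = trans (normSq-* z (z ^ℂ n)) (*-congˡ (normSq-^ z n))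

  normSq-fromℝ : ∀ x → normSq (fromℝ x) ≈ x * x
  normSq-fromℝ x = solve 1 (λ x → x :* x :+ con (+ 0) :* con (+ 0) := x :* x) refl x

  ∣∣ℂ-nonneg : ∀ z → 0# ≤ ∣ z ∣ℂ
  ∣∣ℂ-nonneg z = √-nonneg (normSq-nonneg z)

  normSq≈∣∣ℂ² : ∀ z → normSq z ≈ ∣ z ∣ℂ * ∣ z ∣ℂ
  normSq≈∣∣ℂ² z = sym (√-square (normSq-nonneg z))

  ∣∣ℂ≤ : ∀ {z b} → 0# ≤ b → normSq z ≤ b * b → ∣ z ∣ℂ ≤ b
  ∣∣ℂ≤ {z} 0≤b ≤b² = square-cancel-≤ 0≤b (≤-resp (normSq≈∣∣ℂ² z) refl ≤b²)

  ∣∣≤-from-square : ∀ {x b} → 0# ≤ b → x * x ≤ b * b → ∣ x ∣ ≤ b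
  ∣∣≤-from-square {x} 0≤b ≤b² = ∣∣-least (square-cancel-≤ 0≤b ≤b²)
    (square-cancel-≤ 0≤b (≤-resp (solve 1 (λ x → x :* x := (:- x) :* (:- x)) refl x) refl ≤b²))

  ∣re∣≤ : ∀ {z b} → 0# ≤ b → normSq z ≤ b * b → ∣ re z ∣ ≤ b
  ∣re∣≤ {z} 0≤b ≤b² = ∣∣≤-from-square 0≤b (≤-trans (≤-byDifference (0≤square (im z)) refl) ≤b²)

  ∣im∣≤ : ∀ {z b} → 0# ≤ b → normSq z ≤ b * b → ∣ im z ∣ ≤ b
  ∣im∣≤ {z} 0≤b ≤b² = ∣∣≤-from-square 0≤b (≤-trans (≤-byDifference (0≤square (re z)) (+-comm _ _)) ≤b²)

  square≤ : ∀ {x b} → ∣ x ∣ ≤ b → x * x ≤ b * b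
  square≤ ∣x∣≤b = ≤-trans (x≤∣x∣ _) (∣∣-* ∣x∣≤b ∣x∣≤b)

  ∣∣ℂ≤-components : ∀ {z b} → ∣ re z ∣ ≤ b → ∣ im z ∣ ≤ b → ∣ z ∣ℂ ≤ b + b
  ∣∣ℂ≤-components {z} {b} ∣re∣≤b ∣im∣≤b =
    ∣∣ℂ≤ {z} (+-nonneg 0≤b 0≤b) (≤-trans (+-mono-≤ (square≤ ∣re∣≤b) (square≤ ∣im∣≤b))
    (≤-byDifference (+-nonneg (0≤square b) (0≤square b))
      (solve 1 (λ b → b :* b :+ b :* b :+ (b :* b :+ b :* b) := (b :+ b) :* (b :+ b)) refl b)))
    where 0≤b = ≤-trans (∣∣-nonneg _) ∣re∣≤b

  re-partialSum : ∀ a n → re (partialSumℂ a n) ≈ partialSum (re ∘ a) n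
  re-partialSum a zero    = refl
  re-partialSum a (suc n) = +-congʳ (re-partialSum a n)

  im-partialSum : ∀ a n → im (partialSumℂ a n) ≈ partialSum (im ∘ a) n
  im-partialSum a zero    = refl
  im-partialSum a (suc n) = +-congʳ (im-partialSum a n)

  -- A positive r above R carries the estimates, so that q r is a legitimate geometric ratio
  -- whatever the sign of R.
  module PowerSeriesConvergence {v : ℕ → Carrier} {K q r R : Carrier}
    (0≤v : ∀ n → 0# ≤ v n) (0≤K : 0# ≤ K) (0<q : 0# < q)
    (v≤ : ∀ n → v n ≤ K * q ^ n) (0<r : 0# < r) (qr<1 : q * r < 1#) (R≤r : R ≤ r) where

    term : ℕ → ℂ → ℂ
    term n τ = fromℝ (v n) *ℂ τ ^ℂ n

    private
      ρ = q * r
      0<ρ : 0# < ρ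
      0<ρ = *-pos 0<q 0<r
      0≤Kρⁿ : ∀ n → 0# ≤ K * ρ ^ n
      0≤Kρⁿ n = *-nonneg 0≤K (^-nonneg n (<⇒≤ 0<ρ))

      normSq-term≤ : ∀ τ → ClosedDisc R τ → ∀ n → normSq (term n τ) ≤ (K * ρ ^ n) * (K * ρ ^ n)
      normSq-term≤ τ τ∈ n = begin
        normSq (term n τ)                    ≈⟨ normSq-* (fromℝ (v n)) (τ ^ℂ n) ⟩
        normSq (fromℝ (v n)) * normSq (τ ^ℂ n) ≈⟨ *-cong (normSq-fromℝ (v n)) (normSq-^ τ n) ⟩
        v n * v n * normSq τ ^ n
          ≤⟨ *-mono-≤ (0≤square (v n)) (^-nonneg n (0≤square r))
               (*-mono-≤ (0≤v n) (≤-trans (0≤v n) (v≤ n)) (v≤ n) (v≤ n))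
               (^-monoˡ-≤ n (normSq-nonneg τ) (≤-resp (sym (normSq≈∣∣ℂ² τ)) refl
                 (*-mono-≤ (∣∣ℂ-nonneg τ) (<⇒≤ 0<r) ∣τ∣≤r ∣τ∣≤r))) ⟩
        K * q ^ n * (K * q ^ n) * (r * r) ^ n
          ≈⟨ *-congˡ (^-distrib-* r r n) ⟩
        K * q ^ n * (K * q ^ n) * (r ^ n * r ^ n)
          ≈⟨ solve 3 (λ k q r → k :* q :* (k :* q) :* (r :* r) :=
               k :* (q :* r) :* (k :* (q :* r))) refl K (q ^ n) (r ^ n) ⟩
        K * (q ^ n * r ^ n) * (K * (q ^ n * r ^ n))
          ≈⟨ *-cong (*-congˡ (^-distrib-* q r n)) (*-congˡ (^-distrib-* q r n)) ⟨
        K * ρ ^ n * (K * ρ ^ n)              ∎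
        where
        open ≤-Reasoning
        ∣τ∣≤r : ∣ τ ∣ℂ ≤ r
        ∣τ∣≤r = ≤-trans τ∈ R≤r

      norm≤ : ∀ τ → ClosedDisc R τ → ∀ n → ∣ ∣ term n τ ∣ℂ ∣ ≤ K * ρ ^ n
      norm≤ τ τ∈ n = ≤-resp (sym (∣∣-of-nonneg (∣∣ℂ-nonneg (term n τ))))
           refl (∣∣ℂ≤ {term n τ} (0≤Kρⁿ n) (normSq-term≤ τ τ∈ n))

      re≤ : ∀ τ → ClosedDisc R τ → ∀ n → ∣ re (term n τ) ∣ ≤ K * ρ ^ n
      re≤ τ τ∈ n = ∣re∣≤ {term n τ} (0≤Kρⁿ n) (normSq-term≤ τ τ∈ n)

      im≤ : ∀ τ → ClosedDisc R τ → ∀ n → ∣ im (term n τ) ∣ ≤ K * ρ ^ n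
      im≤ τ τ∈ n = ∣im∣≤ {term n τ} (0≤Kρⁿ n) (normSq-term≤ τ τ∈ n)

      module Norm (τ : ℂ) (τ∈ : ClosedDisc R τ) = GeometricallyBounded 0<ρ qr<1 0≤K (norm≤ τ τ∈)
      module Re (τ : ℂ) (τ∈ : ClosedDisc R τ) = GeometricallyBounded 0<ρ qr<1 0≤K (re≤ τ τ∈)
      module Im (τ : ℂ) (τ∈ : ClosedDisc R τ) = GeometricallyBounded 0<ρ qr<1 0≤K (im≤ τ τ∈)

    absolutely : ∀ τ → ClosedDisc R τ → AbsolutelyConvergent (λ n → term n τ)
    absolutely τ τ∈ = Norm.total τ τ∈ , Norm.sums τ τ∈

    private
      -- Completeness is available for ℝ, so the complex sum is assembled from its two coordinates.
      limit : ∀ τ → ClosedDisc R τ → ℂ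
      limit τ τ∈ = Re.total τ τ∈ +i Im.total τ τ∈
      1-ρ#0 : 1# - ρ # 0#
      1-ρ#0 = pos⇒#0 (0<difference qr<1)
      -- The `bound` of both `Re` and `Im`, written without τ: an index chosen from it serves the
      -- whole disc.
      bound : Carrier
      bound = K * inv (1# - ρ) 1-ρ#0
      0≤bound : 0# ≤ bound
      0≤bound = *-nonneg 0≤K (<⇒≤ (inv-pos _ 1-ρ#0 (0<difference qr<1)))
      small : ∀ ε → 0# < ε → ∃[ N ] (∀ n → N ℕ.≤ n → (bound + bound) * ρ ^ n < ε)
      small = powers-vanish 0<ρ qr<1 (+-nonneg 0≤bound 0≤bound)
      P : ℂ → ℕ → ℂ
      P τ = partialSumℂ (λ k → term k τ)
      re-close : ∀ τ (τ∈ : ClosedDisc R τ) n → ∣ re (P τ n) - Re.total τ τ∈ ∣ ≤ bound * ρ ^ n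
      re-close τ τ∈ n =
        ≤-trans (≤-reflexive (∣∣-cong (+-congʳ (re-partialSum (λ k → term k τ) n)))) (Re.error-bound τ τ∈ n)
      im-close : ∀ τ (τ∈ : ClosedDisc R τ) n → ∣ im (P τ n) - Im.total τ τ∈ ∣ ≤ bound * ρ ^ n
      im-close τ τ∈ n =
        ≤-trans (≤-reflexive (∣∣-cong (+-congʳ (im-partialSum (λ k → term k τ) n)))) (Im.error-bound τ τ∈ n)
      close : ∀ τ (τ∈ : ClosedDisc R τ) n → ∣ P τ n -ℂ limit τ τ∈ ∣ℂ ≤ (bound + bound) * ρ ^ n
      close τ τ∈ n = ≤-trans
        (∣∣ℂ≤-components {P τ n -ℂ limit τ τ∈} (re-close τ τ∈ n) (im-close τ τ∈ n))
        (≤-reflexive (sym (distribʳ (ρ ^ n) bound bound)))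

    uniformly : UniformlyConvergentOn (ClosedDisc R) term
    uniformly = limit , λ ε 0<ε → proj₁ (small ε 0<ε) , λ n N≤n τ τ∈ →
      ≤-<-trans (close τ τ∈ n) (proj₂ (small ε 0<ε) n N≤n)

-- Representatives of opposite residues.

module _ {m : ℕ} .{{_ : ℕ.NonZero m}} where
  open ℕₚ.≤-Reasoning

  sum≡m⇒%≡0 : ∀ {a b} → a ℕ.+ b ≡ m → (a ℕ.+ b) % m ≡ 0
  sum≡m⇒%≡0 ≡.refl = n%n≡0 m

  -- The sum lies strictly between 0 and 2 m, and m is the only multiple of m there: the excess a +
  -- b - m is below m and has remainder 0.
  %≡0⇒sum≡m : ∀ {a b} → a ℕ.< m → b ℕ.< m → b ≢ 0 → (a ℕ.+ b) % m ≡ 0 → a ℕ.+ b ≡ m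
  %≡0⇒sum≡m {a} {b} a<m b<m b≢0 %≡0 with (a ℕ.+ b) ℕₚ.<? m
  ... | yes a+b<m = contradiction (ℕₚ.m+n≡0⇒n≡0 a (≡.trans (≡.sym (m<n⇒m%n≡m a+b<m)) %≡0)) b≢0
  ... | no  a+b≮m = ℕₚ.≤-antisym (ℕₚ.m∸n≡0⇒m≤n excess≡0) m≤a+b
    where
    m≤a+b = ℕₚ.≮⇒≥ a+b≮m
    excess<m : (a ℕ.+ b) ℕ.∸ m ℕ.< m
    excess<m = begin-strict
      (a ℕ.+ b) ℕ.∸ m <⟨ ℕₚ.∸-monoˡ-< (ℕₚ.+-mono-< a<m b<m) m≤a+b ⟩
      (m ℕ.+ m) ℕ.∸ m ≡⟨ ℕₚ.m+n∸n≡m m m ⟩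
      m               ∎
    excess≡0 : (a ℕ.+ b) ℕ.∸ m ≡ 0
    excess≡0 = ≡.trans (≡.sym (m<n⇒m%n≡m excess<m)) (≡.trans (m≤n⇒[n∸m]%m≡n%m m≤a+b) %≡0)

-- The Verlinde sum as a zeta value, its generating function and its convergence.

module VerlindeZeta {c ℓ₁ ℓ₂} (ℝ : RealField c ℓ₁ ℓ₂) (T : Trigonometry ℝ) (m : ℕ) (3≤m : 3 ℕ.≤ m) where
  open RealField ℝ
  open RealFieldProperties ℝ
  open RationalFunctions ℝ
  open OrderedField ℝ
  open FormalPowerSeries ℝ
  open Limits ℝ
  open TrigonometricSeries ℝ using (sin-reflection)
  open FiniteSums ℝ
  open Complex ℝ
  open ComplexSeries ℝ
  open Trigonometry T
  open Verlinde ℝ T m 3≤m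
  open SpectralZeta ℝ λₘ λₘ#0
  open SetoidReasoning setoid

  ZeroFree : Pred G _
  ZeroFree j = ¬ Z j

  -- The same decision procedure as inside `allG∖Z`, so that `sumOver-select` applies to `ζ` as it
  -- stands.
  zeroFree? : Decidable ZeroFree
  zeroFree? (a , b) = ¬? (isZero? a ⊎-dec isZero? b ⊎-dec isZero? (a +ₘ b))

  private
    toℕ-+ₘ : ∀ a b → toℕ (a +ₘ b) ≡ (toℕ a ℕ.+ toℕ b) % m
    toℕ-+ₘ a b = toℕ-fromℕ< (m%n<n (toℕ a ℕ.+ toℕ b) m)

  -- It makes the angles π r / m and π k / m add up to π, as `sin-reflection` demands.
  opposite-sum : ∀ {r k} → ¬ IsZero k → IsZero (r +ₘ k) → toℕ r ℕ.+ toℕ k ≡ m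
  opposite-sum {r} {k} k≢0 r+k≡0 = %≡0⇒sum≡m (toℕ<n r) (toℕ<n k) k≢0 (≡.trans (≡.sym (toℕ-+ₘ r k)) r+k≡0)

  triple⇒zeroFree : ∀ {j ℓ k} → Triple (j , ℓ , k) → ZeroFree (j , ℓ)
  triple⇒zeroFree ((j≢0 , ℓ≢0 , k≢0) , sum≡0) (inj₁ j≡0)        = j≢0 j≡0
  triple⇒zeroFree ((j≢0 , ℓ≢0 , k≢0) , sum≡0) (inj₂ (inj₁ ℓ≡0)) = ℓ≢0 ℓ≡0
  -- With j + ℓ ≡ 0 the representative of k would have to be m itself, which is out of range.
  triple⇒zeroFree {j} {ℓ} {k} ((j≢0 , ℓ≢0 , k≢0) , sum≡0) (inj₂ (inj₂ r≡0)) =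
    ℕₚ.<-irrefl (≡.trans (≡.cong (ℕ._+ toℕ k) (≡.sym r≡0)) (opposite-sum {j +ₘ ℓ} {k} k≢0 sum≡0)) (toℕ<n k)

  module _ {j ℓ : ℤ/m} (j,ℓ∉Z : ZeroFree (j , ℓ)) where
    private
      r = j +ₘ ℓ
      r≢0 : toℕ r ≢ 0
      r≢0 r≡0 = j,ℓ∉Z (inj₂ (inj₂ r≡0))
      m∸r<m : m ℕ.∸ toℕ r ℕ.< m
      m∸r<m = ℕₚ.∸-monoʳ-< (ℕₚ.n≢0⇒n>0 r≢0) (ℕₚ.<⇒≤ (toℕ<n r))

    -- This is - (j + ℓ); its representative m - r stays below m because r is nonzero off `Z`.
    third : ℤ/m
    third = fromℕ< m∸r<m

    private
      r+third≡m : toℕ r ℕ.+ toℕ third ≡ m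
      r+third≡m = ≡.trans (≡.cong (toℕ r ℕ.+_) (toℕ-fromℕ< m∸r<m)) (ℕₚ.m+[n∸m]≡n (ℕₚ.<⇒≤ (toℕ<n r)))

    third-triple : Triple (j , ℓ , third)
    third-triple = ((j,ℓ∉Z ∘ inj₁) , (j,ℓ∉Z ∘ inj₂ ∘ inj₁) , third≢0) ,
      ≡.trans (toℕ-+ₘ r third) (sum≡m⇒%≡0 {a = toℕ r} {toℕ third} r+third≡m)
      where
      third≢0 : ¬ IsZero third
      third≢0 third≡0 = ℕₚ.<-irrefl (≡.trans (≡.sym (ℕₚ.+-identityʳ (toℕ r)))
        (≡.trans (≡.cong (toℕ r ℕ.+_) (≡.sym third≡0)) r+third≡m)) (toℕ<n r)

    third-unique : ∀ {k} → Triple (j , ℓ , k) → k ≡ third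
    third-unique {k} ((_ , _ , k≢0) , sum≡0) = Finₚ.toℕ-injective (ℕₚ.+-cancelˡ-≡ (toℕ r) (toℕ k) (toℕ third)
      (≡.trans (opposite-sum {r} {k} k≢0 sum≡0) (≡.sym r+third≡m)))

  inv4 : Carrier
  inv4 = inv (fromℕ 4) (fromℕ#0 4)

  verlindeTerm : ℕ → Σ _ Triple → Carrier
  verlindeTerm n (t , t∈) = inv (sineProduct t) (sineProduct#0 t∈) ^ (2 ℕ.* n)

  sineProduct² : ∀ {j ℓ k} → Triple (j , ℓ , k) →
    sineProduct (j , ℓ , k) ^ 2 ≈ fromℕ 4 * eigenvalue (j , ℓ)
  sineProduct² {j} {ℓ} {k} ((_ , _ , k≢0) , sum≡0) = begin
    sineProduct (j , ℓ , k) ^ 2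
      -- 64 is split as 4 · 16, where 16 belongs to the eigenvalue; the square of the third sine is
      -- set apart for the reflection.
      ≈⟨ solve 3 (λ a b c → let p = con (+ 8) :* a :* b :* c in p :* (p :* con (+ 1)) :=
           con (+ 4) :* (con (+ 16) :* (a :* (a :* con (+ 1))) :* (b :* (b :* con (+ 1)))) :* (c :* c))
           refl (sinπ/m j) (sinπ/m ℓ) (sinπ/m k) ⟩
    fromℕ 4 * (fromℕ 16 * sinπ/m j ^ 2 * sinπ/m ℓ ^ 2) * (sinπ/m k * sinπ/m k)
      ≈⟨ *-congˡ (sin-reflection T (/ℕ-sum π-pos m (toℕ (j +ₘ ℓ)) (toℕ k)
           (opposite-sum {j +ₘ ℓ} {k} k≢0 sum≡0))) ⟨
    fromℕ 4 * (fromℕ 16 * sinπ/m j ^ 2 * sinπ/m ℓ ^ 2) * (sinπ/m (j +ₘ ℓ) * sinπ/m (j +ₘ ℓ))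
      ≈⟨ solve 3 (λ f p s → f :* p :* (s :* s) := f :* (p :* (s :* (s :* con (+ 1))))) refl (fromℕ 4)
           (fromℕ 16 * sinπ/m j ^ 2 * sinπ/m ℓ ^ 2) (sinπ/m (j +ₘ ℓ)) ⟩
    fromℕ 4 * eigenvalue (j , ℓ) ∎

  -- The square of p⁻¹ and the product a⁻¹ b⁻¹ both invert p², and inverses are unique.
  inverse-even-power : ∀ {p p⁻¹ a a⁻¹ b b⁻¹} → p * p⁻¹ ≈ 1# → a * a⁻¹ ≈ 1# → b * b⁻¹ ≈ 1# →
                       p ^ 2 ≈ a * b → ∀ n → p⁻¹ ^ (2 ℕ.* n) ≈ a⁻¹ ^ n * b⁻¹ ^ n
  inverse-even-power {p} {p⁻¹} {a} {a⁻¹} {b} {b⁻¹} pp⁻¹≈1 aa⁻¹≈1 bb⁻¹≈1 p²≈ab n = begin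
    p⁻¹ ^ (2 ℕ.* n)     ≈⟨ ^-assocʳ p⁻¹ 2 n ⟨
    (p⁻¹ ^ 2) ^ n       ≈⟨ ^-congˡ n (inverse-unique square-inverse product-inverse) ⟩
    (a⁻¹ * b⁻¹) ^ n     ≈⟨ ^-distrib-* a⁻¹ b⁻¹ n ⟩
    a⁻¹ ^ n * b⁻¹ ^ n   ∎
    where
    square-inverse : p ^ 2 * p⁻¹ ^ 2 ≈ 1#
    square-inverse = begin
      p ^ 2 * p⁻¹ ^ 2         ≈⟨ ^-distrib-* p p⁻¹ 2 ⟨
      (p * p⁻¹) ^ 2           ≈⟨ ^-congˡ 2 pp⁻¹≈1 ⟩
      1# ^ 2                  ≈⟨ trans (*-identityˡ _) (*-identityˡ _) ⟩
      1#                      ∎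
    product-inverse : p ^ 2 * (a⁻¹ * b⁻¹) ≈ 1#
    product-inverse = begin
      p ^ 2 * (a⁻¹ * b⁻¹)     ≈⟨ *-congʳ p²≈ab ⟩
      a * b * (a⁻¹ * b⁻¹)
        ≈⟨ solve 4 (λ a b c d → a :* b :* (c :* d) := a :* c :* (b :* d)) refl a b a⁻¹ b⁻¹ ⟩
      a * a⁻¹ * (b * b⁻¹)     ≈⟨ *-cong aa⁻¹≈1 bb⁻¹≈1 ⟩
      1# * 1#                 ≈⟨ *-identityˡ 1# ⟩
      1#                      ∎

  verlindeTerm≈ : ∀ n {j ℓ k} (t∈ : Triple (j , ℓ , k)) (j,ℓ∉Z : ZeroFree (j , ℓ)) →
    verlindeTerm n ((j , ℓ , k) , t∈) ≈ inv4 ^ n * invPower n ((j , ℓ) , j,ℓ∉Z)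
  verlindeTerm≈ n {j} {ℓ} {k} t∈ j,ℓ∉Z = inverse-even-power pp⁻¹≈1 4*inv4≈1 λλ⁻¹≈1 p²≈4λ n
    where
    p λⱼ : Carrier
    p  = sineProduct (j , ℓ , k)
    λⱼ = λₘ ((j , ℓ) , j,ℓ∉Z)
    pp⁻¹≈1 : p * inv p (sineProduct#0 {j , ℓ , k} t∈) ≈ 1#
    pp⁻¹≈1 = inv-inverseʳ p (sineProduct#0 {j , ℓ , k} t∈)
    4*inv4≈1 : fromℕ 4 * inv4 ≈ 1#
    4*inv4≈1 = inv-inverseʳ (fromℕ 4) (fromℕ#0 4)
    λλ⁻¹≈1 : λⱼ * inv λⱼ (λₘ#0 ((j , ℓ) , j,ℓ∉Z)) ≈ 1#
    λλ⁻¹≈1 = inv-inverseʳ λⱼ (λₘ#0 ((j , ℓ) , j,ℓ∉Z))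
    p²≈4λ : p ^ 2 ≈ fromℕ 4 * λⱼ
    p²≈4λ = sineProduct² {j} {ℓ} {k} t∈

  private
    fiber : ℕ → ℤ/m → ℤ/m → ℤ/m → Carrier
    fiber n j ℓ k = extendByZero (triple? (j , ℓ , k)) λ t∈ → verlindeTerm n ((j , ℓ , k) , t∈)

    -- A pair off `Z` is completed to a triple by exactly one k, a pair in `Z` by none. So the inner
    -- sum has at most one nonzero term, and the sum over triples becomes one over pairs.
    fiber-sum : ∀ n j ℓ (d : Dec (ZeroFree (j , ℓ))) → sumOver (allFin m) (fiber n j ℓ) ≈
      extendByZero d λ j,ℓ∉Z → inv4 ^ n * invPower n ((j , ℓ) , j,ℓ∉Z)
    fiber-sum n j ℓ (no j,ℓ∈Z) = sumOver-zero (allFin m) λ k →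
      extendByZero-no (triple? (j , ℓ , k)) λ t∈ → j,ℓ∈Z (triple⇒zeroFree {j} {ℓ} {k} t∈)
    fiber-sum n j ℓ (yes j,ℓ∉Z) = trans
      (sumOver-tabulate-single id (fiber n j ℓ) k₀ λ k k≢k₀ →
        extendByZero-no (triple? (j , ℓ , k)) λ t∈ → k≢k₀ (third-unique j,ℓ∉Z t∈))
      (extendByZero-yes (triple? (j , ℓ , k₀)) (third-triple j,ℓ∉Z) λ t∈ → verlindeTerm≈ n t∈ j,ℓ∉Z)
      where
      k₀ : ℤ/m
      k₀ = third j,ℓ∉Z

  sum-verlindeTerm : ∀ n → sumOver triples (verlindeTerm n) ≈ inv4 ^ n * ζ n
  sum-verlindeTerm n = begin
    sumOver triples (verlindeTerm n)
      ≈⟨ sumOver-select triple? (cartesianProduct ℤs (cartesianProduct ℤs ℤs)) (verlindeTerm n) ⟩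
    sumOver (cartesianProduct ℤs (cartesianProduct ℤs ℤs)) (λ (j , ℓ , k) → fiber n j ℓ k)
      ≈⟨ sumOver-cartesianProduct ℤs (cartesianProduct ℤs ℤs) (λ (j , ℓ , k) → fiber n j ℓ k) ⟩
    sumOver ℤs (λ j → sumOver (cartesianProduct ℤs ℤs) λ (ℓ , k) → fiber n j ℓ k)
      ≈⟨ sumOver-cong ℤs (λ j → sumOver-cartesianProduct ℤs ℤs (λ (ℓ , k) → fiber n j ℓ k)) ⟩
    sumOver ℤs (λ j → sumOver ℤs λ ℓ → sumOver ℤs λ k → fiber n j ℓ k)
      ≈⟨ sumOver-cong ℤs (λ j → sumOver-cong ℤs λ ℓ →
           trans (fiber-sum n j ℓ (zeroFree? (j , ℓ))) (extendByZero-* (zeroFree? (j , ℓ)) (inv4 ^ n) _)) ⟩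
    sumOver ℤs (λ j → sumOver ℤs λ ℓ → inv4 ^ n * g (j , ℓ))
      ≈⟨ sumOver-cartesianProduct ℤs ℤs (λ x → inv4 ^ n * g x) ⟨
    sumOver (cartesianProduct ℤs ℤs) (λ x → inv4 ^ n * g x)
      ≈⟨ *-sumOver (inv4 ^ n) (cartesianProduct ℤs ℤs) g ⟨
    inv4 ^ n * sumOver (cartesianProduct ℤs ℤs) g
      ≈⟨ *-congˡ (sumOver-select zeroFree? (cartesianProduct ℤs ℤs) (invPower n)) ⟨
    inv4 ^ n * ζ n ∎
    where
    ℤs = allFin m
    g : G → Carrier
    g x = extendByZero (zeroFree? x) λ x∉Z → invPower n (x , x∉Z)

  V≈ : ∀ n → V n ≈ cₘ ^ n * ζ n
  V≈ n = begin
    fromℕ 3 ^ n * fromℕ m ^ (2 ℕ.* n) * sumOver triples (verlindeTerm n)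
      ≈⟨ *-cong (*-congˡ (sym (^-assocʳ (fromℕ m) 2 n))) (sum-verlindeTerm n) ⟩
    fromℕ 3 ^ n * (fromℕ m ^ 2) ^ n * (inv4 ^ n * ζ n)
      ≈⟨ *-assoc _ _ _ ⟨
    fromℕ 3 ^ n * (fromℕ m ^ 2) ^ n * inv4 ^ n * ζ n
      ≈⟨ *-congʳ (trans (^-distrib-* (fromℕ 3 * fromℕ m ^ 2) inv4 n)
           (*-congʳ (^-distrib-* (fromℕ 3) (fromℕ m ^ 2) n))) ⟨
    cₘ ^ n * ζ n ∎

  m⁻² : Carrier
  m⁻² = inv (fromℕ m ^ 2) m²#0

  F-represents : Represents (m⁻² ∙ λ n → ζ (suc n)) F
  F-represents n = begin
    ((m⁻² ∙ λ n → ζ (suc n)) ⋆ coeff H) n   ≈⟨ ∙-⋆ m⁻² (λ n → ζ (suc n)) (coeff H) n ⟩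
    m⁻² * ((λ n → ζ (suc n)) ⋆ coeff H) n   ≈⟨ *-congˡ (logDerivative allG∖Z n) ⟩
    m⁻² * (- 1# * D (coeff H) n)
      ≈⟨ solve 2 (λ i d → i :* ((:- con (+ 1)) :* d) := (:- i) :* d) refl m⁻² (D (coeff H) n) ⟩
    - m⁻² * D (coeff H) n                    ≈⟨ *-congˡ (coeff-derivative H n) ⟨
    - m⁻² * coeff (derivative H) n           ≈⟨ coeff-⊙ (- m⁻²) (derivative H) n ⟨
    coeff (num F) n                          ∎

  m²*m⁻² : ∀ x → fromℕ m ^ 2 * (m⁻² * x) ≈ x
  m²*m⁻² x = trans (sym (*-assoc _ _ _)) (trans (*-congʳ (inv-inverseʳ _ m²#0)) (*-identityˡ x))

  V≈valueAt : ∀ n → 1 ℕ.≤ n →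
    V n ≈ fromℕ 3 ^ n * (fromℕ m /ℕ 2) ^ (2 ℕ.* n)
          * (_/ℕ_ (fromℕ m ^ 2) ((n ℕ.∸ 1) !) {{(n ℕ.∸ 1) !≢0}})
          * valueAt 0# (∂^ (n ℕ.∸ 1) F) (∂^-regular (n ℕ.∸ 1) F H₀#0)
  V≈valueAt (suc k) _ = begin
    V n
      ≈⟨ V≈ n ⟩
    cₘ ^ n * ζ n
      ≈⟨ *-cong (trans (^-congˡ n cₘ≈) (^-distrib-* (fromℕ 3) (m/2 ^ 2) n)) (sym (m²*m⁻² (ζ n))) ⟩
    fromℕ 3 ^ n * (m/2 ^ 2) ^ n * (fromℕ m ^ 2 * (m⁻² * ζ n))
      -- The inserted k ! k!⁻¹ = 1 is shared out: k ! turns the coefficient into the k-th derivative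
      -- at 0, and k!⁻¹ joins the prefactor m².
      ≈⟨ *-cong (*-congˡ (^-assocʳ m/2 2 n))
           (trans (sym (*-identityˡ _)) (*-congʳ (sym (inv-inverseʳ _ (fromℕ#0 (k !)))))) ⟩
    fromℕ 3 ^ n * m/2 ^ (2 ℕ.* n) * (fromℕ (k !) * k!⁻¹ * (fromℕ m ^ 2 * (m⁻² * ζ n)))
      ≈⟨ solve 5 (λ a f i s z → a :* (f :* i :* (s :* z)) := a :* (s :* i) :* (f :* z)) refl
           (fromℕ 3 ^ n * m/2 ^ (2 ℕ.* n)) (fromℕ (k !)) k!⁻¹ (fromℕ m ^ 2) (m⁻² * ζ n) ⟩
    fromℕ 3 ^ n * m/2 ^ (2 ℕ.* n) * (fromℕ m ^ 2 * k!⁻¹) * (fromℕ (k !) * (m⁻² * ζ n))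
      ≈⟨ *-congˡ (valueAt-∂^ k F (∂^-regular k F H₀#0) F-represents) ⟨
    fromℕ 3 ^ n * m/2 ^ (2 ℕ.* n) * (fromℕ m ^ 2 * k!⁻¹) * valueAt 0# (∂^ k F) (∂^-regular k F H₀#0) ∎
    where
    instance k!≢0 = k !≢0
    n = suc k
    k!⁻¹ = inv (fromℕ (k !)) (fromℕ#0 (k !))
    m/2 = fromℕ m /ℕ 2
    inv2 = inv (fromℕ 2) (fromℕ#0 2)
    2*inv2 = inv-inverseʳ (fromℕ 2) (fromℕ#0 2)
    inv4≈ : inv4 ≈ inv2 * inv2
    inv4≈ = inverse-unique (inv-inverseʳ (fromℕ 4) (fromℕ#0 4)) (begin
      fromℕ 4 * (inv2 * inv2)
        ≈⟨ solve 1 (λ i → con (+ 4) :* (i :* i) := con (+ 2) :* i :* (con (+ 2) :* i)) refl inv2 ⟩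
      fromℕ 2 * inv2 * (fromℕ 2 * inv2)   ≈⟨ *-cong 2*inv2 2*inv2 ⟩
      1# * 1#                             ≈⟨ *-identityˡ 1# ⟩
      1#                                  ∎)
    cₘ≈ : cₘ ≈ fromℕ 3 * m/2 ^ 2
    cₘ≈ = trans (*-congˡ inv4≈) (solve 3 (λ t m i →
      t :* (m :* (m :* con (+ 1))) :* (i :* i) :=
           t :* (m :* i :* (m :* i :* con (+ 1)))) refl (fromℕ 3) (fromℕ m) inv2)

  -- The prefactor cₘ τ makes up for the shift in the expansion of `F`, whose n-th coefficient
  -- carries ζ (n + 1) but after substitution only the n-th power of cₘ.
  generatingFunction : verlindeSeries ≋ cₘ ∙ τ∙ (fromℕ m ^ 2 ∙ (expansion F H₀#0 [ cₘ τ]))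
  generatingFunction zero    = sym (zeroʳ cₘ)
  generatingFunction (suc n) = begin
    V (suc n)                                              ≈⟨ V≈ (suc n) ⟩
    cₘ * cₘ ^ n * ζ (suc n)                                ≈⟨ *-assoc _ _ _ ⟩
    cₘ * (cₘ ^ n * ζ (suc n))                              ≈⟨ *-congˡ (m²*m⁻² _) ⟨
    cₘ * (fromℕ m ^ 2 * (m⁻² * (cₘ ^ n * ζ (suc n))))
      ≈⟨ *-congˡ (*-congˡ (*-leftSwap m⁻² (cₘ ^ n) (ζ (suc n)))) ⟩
    cₘ * (fromℕ m ^ 2 * (cₘ ^ n * (m⁻² * ζ (suc n))))
      ≈⟨ *-congˡ (*-congˡ (*-congˡ (expansion-unique F H₀#0 F-represents n))) ⟨
    cₘ * (fromℕ m ^ 2 * (cₘ ^ n * expansion F H₀#0 n))     ∎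

  private
    0<cₘ : 0# < cₘ
    0<cₘ = *-pos (*-pos (fromℕ-pos 3) (^-pos 2 (fromℕ-pos m))) (inv-pos _ (fromℕ#0 4) (fromℕ-pos 4))

    0≤x^2 : ∀ x → 0# ≤ x ^ 2
    0≤x^2 x = ≤-resp refl (*-congˡ (sym (*-identityʳ x))) (0≤square x)

    0≤λₘ : ∀ j → 0# ≤ λₘ j
    0≤λₘ ((a , b) , _) = *-nonneg (*-nonneg (*-nonneg (fromℕ-nonneg 16) (0≤x^2 (sinπ/m a))) (0≤x^2 (sinπ/m b)))
                                  (0≤x^2 (sinπ/m (a +ₘ b)))

    0<min : 0# < minEigenvalue
    0<min = foldr-⊓-pos 0≤λₘ (0<ev 0≤λₘ [1,1]) allG∖Z

    min#0 = pos⇒#0 0<min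
    min⁻¹ = inv minEigenvalue min#0

    K q : Carrier
    K = fromℕ (length allG∖Z)
    q = cₘ * min⁻¹

    0≤K : 0# ≤ K
    0≤K = fromℕ-nonneg (length allG∖Z)

    0<q : 0# < q
    0<q = *-pos 0<cₘ (inv-pos _ min#0 0<min)

    0≤V : ∀ n → 0# ≤ V n
    0≤V n = ≤-resp refl (sym (V≈ n))
      (*-nonneg (^-nonneg n (<⇒≤ 0<cₘ)) (sumOver-nonneg allG∖Z (0≤invPower 0≤λₘ n)))

    V≤ : ∀ n → V n ≤ K * q ^ n
    V≤ n = ≤-resp (sym (V≈ n)) (trans (*-leftSwap _ _ _) (*-congˡ (sym (^-distrib-* cₘ min⁻¹ n))))
      (*-monoˡ-≤ (^-nonneg n (<⇒≤ 0<cₘ)) (sumOver-invPower-bound 0≤λₘ min#0 0<min n allG∖Z ≤-refl))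

    0≤series : ∀ n → 0# ≤ verlindeSeries n
    0≤series zero    = ≤-refl
    0≤series (suc n) = 0≤V (suc n)

    series≤ : ∀ n → verlindeSeries n ≤ K * q ^ n
    -- The generating series starts at n = 1, so at index 0 the bound only says 0 ≤ K.
    series≤ zero    = ≤-resp refl (sym (*-identityʳ K)) 0≤K
    series≤ (suc n) = V≤ (suc n)

  module _ (R : Carrier) (R<b : R < inv cₘ cₘ#0 * minEigenvalue) where
    private
      b = inv cₘ cₘ#0 * minEigenvalue
      0<b : 0# < b
      0<b = *-pos (inv-pos _ cₘ#0 0<cₘ) 0<min

      qb≈1 : q * b ≈ 1#
      qb≈1 = begin
        cₘ * min⁻¹ * (inv cₘ cₘ#0 * minEigenvalue)
          ≈⟨ solve 4 (λ c i j μ → c :* i :* (j :* μ) :=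
               c :* j :* (μ :* i)) refl cₘ min⁻¹ (inv cₘ cₘ#0) minEigenvalue ⟩
        cₘ * inv cₘ cₘ#0 * (minEigenvalue * min⁻¹)
          ≈⟨ *-cong (inv-inverseʳ cₘ cₘ#0) (inv-inverseʳ minEigenvalue min#0) ⟩
        1# * 1#
          ≈⟨ *-identityˡ 1# ⟩
        1# ∎

      -- R itself may be negative or of undecidable sign.
      positiveRadius : ∃[ r ] (0# < r × r < b × R ≤ r)
      positiveRadius =
        [ (λ 0<R → R , 0<R , R<b , ≤-refl)
        , (λ R<b/2 → half * b , half*-pos 0<b , <-byDifference (half*-pos 0<b) (halves b) , <⇒≤ R<b/2)
        ]′ (<-cotrans (half*-pos 0<b) R)

      r = proj₁ positiveRadius
      qr<1 : q * r < 1#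
      qr<1 = <-resp refl qb≈1 (*-monoˡ-< 0<q (proj₁ (proj₂ (proj₂ positiveRadius))))

      open module Convergence = PowerSeriesConvergence {R = R} 0≤series 0≤K 0<q series≤
        (proj₁ (proj₂ positiveRadius)) qr<1 (proj₂ (proj₂ (proj₂ positiveRadius)))

    convergence :
      (∀ τ → ClosedDisc R τ → AbsolutelyConvergent (λ n → fromℝ (verlindeSeries n) *ℂ τ ^ℂ n))
      × UniformlyConvergentOn (ClosedDisc R) (λ n τ → fromℝ (verlindeSeries n) *ℂ τ ^ℂ n)
    convergence = absolutely , uniformly

theorem1p1 :
  ∀ {c ℓ₁ ℓ₂} (ℝ : RealField c ℓ₁ ℓ₂) (T : Trigonometry ℝ) (m : ℕ) (3≤m : 3 ℕ.≤ m) →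
  let open RealField ℝ
      open RealFieldProperties ℝ
      open RationalFunctions ℝ
      open Complex ℝ
      open Verlinde ℝ T m 3≤m
  in
    (∀ n → 1 ℕ.≤ n → V n ≈ cₘ ^ n * ζ n)
  × (∀ n → 1 ℕ.≤ n →
      V n ≈ fromℕ 3 ^ n * (fromℕ m /ℕ 2) ^ (2 ℕ.* n)
            * (_/ℕ_ (fromℕ m ^ 2) ((n ℕ.∸ 1) !) {{(n ℕ.∸ 1) !≢0}})
            * valueAt 0# (∂^ (n ℕ.∸ 1) F) (∂^-regular (n ℕ.∸ 1) F H₀#0))
  × (verlindeSeries ≋ cₘ ∙ τ∙ (fromℕ m ^ 2 ∙ (expansion F H₀#0 [ cₘ τ])))
  × (∀ R → R < inv cₘ cₘ#0 * minEigenvalue →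
      (∀ τ → ClosedDisc R τ → AbsolutelyConvergent (λ n → fromℝ (verlindeSeries n) *ℂ τ ^ℂ n))
      × UniformlyConvergentOn (ClosedDisc R) (λ n τ → fromℝ (verlindeSeries n) *ℂ τ ^ℂ n))
theorem1p1 ℝ T m 3≤m = (λ n _ → V≈ n) , V≈valueAt , generatingFunction , convergence
  where open VerlindeZeta ℝ T m 3≤m
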